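{- Let $r\in\mathbb{Z}$. Then the following equality holds in $\mathbb{Z}\llbracket x,y\rrbracket$ (in particular, both sides have integer coefficients): $$1+\sum_{n\geq1}\sum_{\sigma\in S_{n}}\frac{y^{n}}{n!}\det(I_{n}-xM_{\sigma})^{r}=\prod_{k\geq0}(1-yx^{k})^{ -\binom{k-r-1}{k}}.$$
   Context: $\mathbb{Z}\llbracket x,y\rrbracket$ is the ring of formal power series in $x,y$ with integer coefficients. $S_n$ is the symmetric group on $n$ letters, $M_\sigma$ is the $n\times n$ permutation matrix of $\sigma\in S_n$, and $I_n$ is the $n\times n$ identity matrix. The polynomial $\det(I_n-xM_\sigma)$ has constant term $1$, so it is invertible as a formal power series in $x$ and its $r$-th power makes sense for every integer $r$. Binomial numbers are defined by $\binom{a}{k}=\frac{a(a-1)\cdots(a-k+1)}{k!}$ for all integers $a$ and $k\ge 0$, with $\binom{a}{0}=1$. The infinite product is understood as a (convergent) product of formal power series. -}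

module Defs where

open import Algebra.Bundles using (CommutativeRing; Semiring)
import Algebra.Construct.Pointwise as Pointwise
import Algebra.Definitions.RawSemiring as RawSemiringDefs
import Algebra.Properties.Ring as RingProperties
import Algebra.Properties.Semiring.Sum as SemiringSum
open import Data.Bool.Base using (if_then_else_)
open import Data.Fin.Base using (Fin; zero; suc; toℕ; punchIn)
open import Data.Fin.Permutation as Perm
  using (Permutation′; _⟨$⟩ʳ_; insert; remove; insert-remove)
open import Data.Fin.Properties using (_≟_; _<?_; punchIn-injective)
open import Data.Integer.Base as ℤ using (ℤ; +_; -[1+_]; 1ℤ)
import Data.Integer.Properties as ℤ
open import Data.List.Base as List using (List; []; _∷_; allFin; cartesianProductWith)
open import Data.List.Membership.Propositional.Properties using (∈-allFin)
open import Data.List.Relation.Unary.All as All using ([])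
import Data.List.Relation.Unary.All.Properties as All
open import Data.List.Relation.Unary.AllPairs as AllPairs using (AllPairs; []; _∷_)
import Data.List.Relation.Unary.AllPairs.Properties as AllPairs
open import Data.List.Relation.Unary.Any as Any using (Any; here)
import Data.List.Relation.Unary.Any.Properties as Any
import Data.List.Relation.Unary.Unique.Propositional.Properties as Unique
open import Data.Nat.Base as ℕ using (ℕ; zero; suc; _∸_; _!)
import Data.Nat.Properties as ℕ
open import Data.Product.Base using (_×_; _,_; ∃-syntax)
open import Data.Rational.Base as ℚ using (ℚ)
import Data.Rational.Properties as ℚ
open import Function.Base using (_∘_)
open import Level using (Level; 0ℓ)
open import Relation.Binary.PropositionalEquality as ≡ using (_≡_)
import Relation.Binary.Reasoning.Setoid as SetoidReasoning
open import Relation.Nullary using (¬_; does)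
open import Relation.Nullary.Decidable using (_×-dec_)

private
  variable
    c ℓ : Level

module PowerSeries (R : CommutativeRing c ℓ) where

  open CommutativeRing R
  open SemiringSum semiring
  open SetoidReasoning setoid

  -- f n is the coefficient of the n-th power of the variable.
  Series : Set c
  Series = ℕ → Carrier

  const : Carrier → Series
  const a zero    = a
  const a (suc _) = 0#

  var : Series
  var zero          = 0#
  var (suc zero)    = 1#
  var (suc (suc _)) = 0#

  infix  4 _≋_
  infixl 6 _⊕_
  infixl 7 _⊛_

  _≋_ : Series → Series → Set ℓ
  f ≋ g = ∀ n → f n ≈ g n

  _⊕_ : Series → Series → Series
  (f ⊕ g) n = f n + g n

  _⊛_ : Series → Series → Series
  (f ⊛ g) n = ∑[ i ≤ n ] (f (toℕ i) * g (n ∸ toℕ i))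

  ⊛-cong : ∀ {f f′ g g′} → f ≋ f′ → g ≋ g′ → f ⊛ g ≋ f′ ⊛ g′
  ⊛-cong p q n = sum-cong-≋ {suc n} λ i → *-cong (p (toℕ i)) (q (n ∸ toℕ i))

  ⊛-distribʳ : ∀ h f g → (f ⊕ g) ⊛ h ≋ f ⊛ h ⊕ g ⊛ h
  ⊛-distribʳ h f g n = trans
    (sum-cong-≋ {suc n} λ i → distribʳ (h (n ∸ toℕ i)) (f (toℕ i)) (g (toℕ i)))
    (∑-distrib-+ {suc n} (λ i → f (toℕ i) * h (n ∸ toℕ i)) (λ i → g (toℕ i) * h (n ∸ toℕ i)))

  ⊛-distribˡ : ∀ h f g → h ⊛ (f ⊕ g) ≋ h ⊛ f ⊕ h ⊛ g
  ⊛-distribˡ h f g n = trans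
    (sum-cong-≋ {suc n} λ i → distribˡ (h (toℕ i)) (f (n ∸ toℕ i)) (g (n ∸ toℕ i)))
    (∑-distrib-+ {suc n} (λ i → h (toℕ i) * f (n ∸ toℕ i)) (λ i → h (toℕ i) * g (n ∸ toℕ i)))

  -- The mirror image of the (definitional) unfolding
  -- (f ⊛ g) (suc n) = f 0 * g (suc n) + ((f ∘ suc) ⊛ g) n.
  ⊛-suc : ∀ f g n → (f ⊛ g) (suc n) ≈ f (suc n) * g 0 + (f ⊛ (g ∘ suc)) n
  ⊛-suc f g zero = begin
    f 0 * g 1 + (f 1 * g 0 + 0#)  ≈⟨ +-assoc _ _ _ ⟨
    f 0 * g 1 + f 1 * g 0 + 0#    ≈⟨ +-congʳ (+-comm _ _) ⟩
    f 1 * g 0 + f 0 * g 1 + 0#    ≈⟨ +-assoc _ _ _ ⟩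
    f 1 * g 0 + (f 0 * g 1 + 0#)  ∎
  ⊛-suc f g (suc n) = begin
    a + ((f ∘ suc) ⊛ g) (suc n)  ≈⟨ +-congˡ (⊛-suc (f ∘ suc) g n) ⟩
    a + (b + d)                  ≈⟨ +-assoc _ _ _ ⟨
    a + b + d                    ≈⟨ +-congʳ (+-comm _ _) ⟩
    b + a + d                    ≈⟨ +-assoc _ _ _ ⟩
    b + (a + d)                  ∎
    where
    a = f 0 * g (suc (suc n))
    b = f (suc (suc n)) * g 0
    d = ((f ∘ suc) ⊛ (g ∘ suc)) n

  ⊛-comm : ∀ f g → f ⊛ g ≋ g ⊛ f
  ⊛-comm f g zero    = +-congʳ (*-comm _ _)
  ⊛-comm f g (suc n) = begin
    f 0 * g (suc n) + ((f ∘ suc) ⊛ g) n  ≈⟨ +-cong (*-comm _ _) (⊛-comm (f ∘ suc) g n) ⟩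
    g (suc n) * f 0 + (g ⊛ (f ∘ suc)) n  ≈⟨ ⊛-suc g f n ⟨
    (g ⊛ f) (suc n)                      ∎

  ⊛-scaleˡ : ∀ a f g → (λ n → a * f n) ⊛ g ≋ λ n → a * (f ⊛ g) n
  ⊛-scaleˡ a f g n = begin
    ∑[ i ≤ n ] (a * f (toℕ i) * g (n ∸ toℕ i))    ≈⟨ sum-cong-≋ {suc n} (λ i → *-assoc a (f (toℕ i)) (g (n ∸ toℕ i))) ⟩
    ∑[ i ≤ n ] (a * (f (toℕ i) * g (n ∸ toℕ i)))  ≈⟨ *-distribˡ-sum {suc n} a (λ i → f (toℕ i) * g (n ∸ toℕ i)) ⟨
    a * (f ⊛ g) n                                 ∎

  ⊛-zeroˡ : ∀ f → (λ _ → 0#) ⊛ f ≋ λ _ → 0#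
  ⊛-zeroˡ f n = trans (sum-cong-≋ {suc n} λ i → zeroˡ (f (n ∸ toℕ i))) (sum-replicate-zero (suc n))

  const-⊛ : ∀ a f → const a ⊛ f ≋ λ n → a * f n
  const-⊛ a f zero    = +-identityʳ _
  const-⊛ a f (suc n) = trans (+-congˡ (⊛-zeroˡ f n)) (+-identityʳ _)

  ⊛-assoc : ∀ f g h → (f ⊛ g) ⊛ h ≋ f ⊛ (g ⊛ h)
  ⊛-assoc f g h zero = +-congʳ (begin
    (f 0 * g 0 + 0#) * h 0  ≈⟨ *-congʳ (+-identityʳ _) ⟩
    f 0 * g 0 * h 0         ≈⟨ *-assoc _ _ _ ⟩
    f 0 * (g 0 * h 0)       ≈⟨ *-congˡ (+-identityʳ _) ⟨
    f 0 * (g 0 * h 0 + 0#)  ∎)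
  ⊛-assoc f g h (suc n) = begin
    (f 0 * g 0 + 0#) * h (suc n) + (((λ m → f 0 * g′ m) ⊕ (f′ ⊛ g)) ⊛ h) n
      ≈⟨ +-cong (trans (*-congʳ (+-identityʳ _)) (*-assoc _ _ _))
                (⊛-distribʳ h (λ m → f 0 * g′ m) (f′ ⊛ g) n) ⟩
    f 0 * (g 0 * h (suc n)) + (((λ m → f 0 * g′ m) ⊛ h) n + ((f′ ⊛ g) ⊛ h) n)
      ≈⟨ +-congˡ (+-cong (⊛-scaleˡ (f 0) g′ h n) (⊛-assoc f′ g h n)) ⟩
    f 0 * (g 0 * h (suc n)) + (f 0 * (g′ ⊛ h) n + (f′ ⊛ (g ⊛ h)) n)
      ≈⟨ +-assoc _ _ _ ⟨
    f 0 * (g 0 * h (suc n)) + f 0 * (g′ ⊛ h) n + (f′ ⊛ (g ⊛ h)) n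
      ≈⟨ +-congʳ (distribˡ _ _ _) ⟨
    f 0 * (g ⊛ h) (suc n) + (f′ ⊛ (g ⊛ h)) n
      ∎
    where
    f′ = f ∘ suc
    g′ = g ∘ suc

  ⊛-identityˡ : ∀ f → const 1# ⊛ f ≋ f
  ⊛-identityˡ f n = trans (const-⊛ 1# f n) (*-identityˡ _)

  commutativeRing : CommutativeRing c ℓ
  commutativeRing = record
    { Carrier = Series
    ; _≈_     = _≋_
    ; _+_     = _⊕_
    ; _*_     = _⊛_
    ; -_      = λ f n → - f n
    ; 0#      = λ _ → 0#
    ; 1#      = const 1#
    ; isCommutativeRing = record
      { isRing = record
        { +-isAbelianGroup = Pointwise.isAbelianGroup ℕ +-isAbelianGroup
        ; *-cong           = ⊛-cong
        ; *-assoc          = ⊛-assoc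
        ; *-identity       = ⊛-identityˡ , λ f n → trans (⊛-comm f (const 1#) n) (⊛-identityˡ f n)
        ; distrib          = ⊛-distribˡ , ⊛-distribʳ
        }
      ; *-comm = ⊛-comm
      }
    }

  private
    module S  = CommutativeRing commutativeRing
    module SP = RingProperties S.ring
  open RawSemiringDefs (Semiring.rawSemiring S.semiring) using () renaming (_^_ to _^ˢ_) public

  -- The inverse of a series f with constant term 1, as the geometric
  -- series ∑ₖ (1 - f)ᵏ: as (1 - f)ᵏ has no terms of degree below k, only
  -- k ≤ n contribute in degree n.  A junk value for other f.
  inv : Series → Series
  inv f n = ∑[ k ≤ n ] (((const 1# S.- f) ^ˢ toℕ k) n)

  infixr 8 _^ℤ_

  -- For negative exponents this is meaningful only if the base has
  -- constant term 1.
  _^ℤ_ : Series → ℤ → Series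
  f ^ℤ (+ n)    = f ^ˢ n
  f ^ℤ -[1+ n ] = inv f ^ˢ suc n

  private
    ^-order : ∀ e → e 0 ≈ 0# → ∀ {k n} → n ℕ.< k → (e ^ˢ k) n ≈ 0#
    ^-order e e₀ {suc k} {zero}  _ = trans (+-identityʳ _) (trans (*-congʳ e₀) (zeroˡ _))
    ^-order e e₀ {suc k} {suc n} (ℕ.s≤s n<k) = begin
      e 0 * (e ^ˢ k) (suc n) + ((e ∘ suc) ⊛ (e ^ˢ k)) n
        ≈⟨ +-cong (trans (*-congʳ e₀) (zeroˡ _)) (sum-cong-≋ {suc n} λ i →
             trans (*-congˡ (^-order e e₀ (ℕ.≤-<-trans (ℕ.m∸n≤m n (toℕ i)) n<k))) (zeroʳ (e (suc (toℕ i))))) ⟩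
      0# + ∑[ i ≤ n ] 0#
        ≈⟨ trans (+-identityˡ _) (sum-replicate-zero (suc n)) ⟩
      0# ∎

    geo : Series → ℕ → Series
    geo e zero    = λ _ → 0#
    geo e (suc N) = const 1# ⊕ e ⊛ geo e N

    geo-∑ : ∀ e N → geo e N ≋ λ n → ∑[ k < N ] ((e ^ˢ toℕ k) n)
    geo-∑ e zero    n = refl
    geo-∑ e (suc N) n = +-congˡ (begin
      ∑[ i ≤ n ] (e (toℕ i) * geo e N (n ∸ toℕ i))
        ≈⟨ sum-cong-≋ {suc n} (λ i → *-congˡ {e (toℕ i)} (geo-∑ e N (n ∸ toℕ i))) ⟩
      ∑[ i ≤ n ] (e (toℕ i) * ∑[ k < N ] ((e ^ˢ toℕ k) (n ∸ toℕ i)))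
        ≈⟨ sum-cong-≋ {suc n} (λ i → *-distribˡ-sum {N} (e (toℕ i)) (λ k → (e ^ˢ toℕ k) (n ∸ toℕ i))) ⟩
      ∑[ i ≤ n ] (∑[ k < N ] (e (toℕ i) * (e ^ˢ toℕ k) (n ∸ toℕ i)))
        ≈⟨ ∑-comm {suc n} {N} (λ i k → e (toℕ i) * (e ^ˢ toℕ k) (n ∸ toℕ i)) ⟩
      ∑[ k < N ] ((e ⊛ (e ^ˢ toℕ k)) n)
        ∎)

    ∑-extend : ∀ (t : ℕ → Carrier) {m N} → m ℕ.≤ N → (∀ {k} → m ℕ.≤ k → t k ≈ 0#) →
               ∑[ k < m ] t (toℕ k) ≈ ∑[ k < N ] t (toℕ k)
    ∑-extend t {N = N} ℕ.z≤n t≈0 =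
      sym (trans (sum-cong-≋ {N} λ k → t≈0 ℕ.z≤n) (sum-replicate-zero N))
    ∑-extend t (ℕ.s≤s m≤N) t≈0 = +-congˡ (∑-extend (t ∘ suc) m≤N (t≈0 ∘ ℕ.s≤s))

  inv-inverseʳ : ∀ f → f 0 ≈ 1# → f ⊛ inv f ≋ const 1#
  inv-inverseʳ f f₀ n = begin
    (f ⊛ inv f) n                            ≈⟨ *-geo ⟩
    (f ⊛ geo e (suc n)) n                    ≈⟨ telescope (suc n) n ⟩
    const 1# n - (e ^ˢ suc n) n              ≈⟨ +-congˡ (-‿cong (^-order e e₀ (ℕ.n<1+n n))) ⟩
    const 1# n - 0#                          ≈⟨ +-congˡ RP.-0#≈0# ⟩
    const 1# n + 0#                          ≈⟨ +-identityʳ _ ⟩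
    const 1# n                               ∎
    where
    module RP = RingProperties ring
    e = const 1# S.- f
    e₀ : e 0 ≈ 0#
    e₀ = trans (+-congˡ (-‿cong f₀)) (-‿inverseʳ 1#)

    inv≈geo : ∀ {m N} → m ℕ.< N → inv f m ≈ geo e N m
    inv≈geo {m} {N} m<N = trans
      (∑-extend (λ k → (e ^ˢ k) m) m<N (^-order e e₀))
      (sym (geo-∑ e N m))

    *-geo : (f ⊛ inv f) n ≈ (f ⊛ geo e (suc n)) n
    *-geo = sum-cong-≋ {suc n} λ i → *-congˡ {f (toℕ i)} (inv≈geo (ℕ.s≤s (ℕ.m∸n≤m n (toℕ i))))

    f≋1-e : f ≋ const 1# S.- e
    f≋1-e m = sym (begin
      a + - (a + - f m)    ≈⟨ +-congˡ (RP.-‿+-comm a (- f m)) ⟨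
      a + (- a + - - f m)  ≈⟨ +-assoc _ _ _ ⟨
      a - a + - - f m      ≈⟨ +-cong (-‿inverseʳ a) (RP.-‿involutive (f m)) ⟩
      0# + f m             ≈⟨ +-identityˡ _ ⟩
      f m                  ∎)
      where a = const 1# m

    cancel : ∀ a b d → (a - b) + (b + d) ≈ a + d
    cancel a b d = begin
      (a - b) + (b + d)    ≈⟨ +-assoc a (- b) _ ⟩
      a + (- b + (b + d))  ≈⟨ +-congˡ (+-assoc (- b) b d) ⟨
      a + (- b + b + d)    ≈⟨ +-congˡ (trans (+-congʳ (-‿inverseˡ b)) (+-identityˡ d)) ⟩
      a + d                ∎

    telescope : ∀ N → f ⊛ geo e N ≋ const 1# S.- e ^ˢ N
    telescope zero    = S.trans (S.zeroʳ f) (S.sym (S.-‿inverseʳ (const 1#)))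
    telescope (suc N) = S.trans
      (S.distribˡ f (const 1#) (e ⊛ geo e N))
      (S.trans (S.+-cong (S.trans (S.*-identityʳ f) f≋1-e) f⊛e⊛geo)
               (λ m → cancel (const 1# m) (e m) (- (e ^ˢ suc N) m)))
      where
      f⊛e⊛geo : f ⊛ (e ⊛ geo e N) ≋ e S.- e ^ˢ suc N
      f⊛e⊛geo =
        S.trans (S.sym (S.*-assoc f e G))
        (S.trans (S.*-congʳ {G} {f ⊛ e} {e ⊛ f} (S.*-comm f e))
        (S.trans (S.*-assoc e f G)
        (S.trans (S.*-congˡ {e} {f ⊛ G} {const 1# S.- eᴺ} (telescope N))
        (S.trans (S.distribˡ e (const 1#) (S.- eᴺ))
        (S.+-cong {e ⊛ const 1#} {e} {e ⊛ (S.- eᴺ)} {S.- (e ⊛ eᴺ)}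
          (S.*-identityʳ e) (S.sym (SP.-‿distribʳ-* e eᴺ)))))))
        where
        G  = geo e N
        eᴺ = e ^ˢ N

-- A permutation π of Fin (suc n) is determined by π 0 and by the
-- permutation of Fin n that π induces away from 0.
perms : ∀ n → List (Permutation′ n)
perms zero    = Perm.id ∷ []
perms (suc n) = cartesianProductWith (insert zero) (allFin (suc n)) (perms n)

perms-complete : ∀ {n} (π : Permutation′ n) → Any (Perm._≈ π) (perms n)
perms-complete {zero}  π = here λ ()
perms-complete {suc n} π =
  Any.cartesianProductWith⁺ (insert zero) combine
    (∈-allFin (π ⟨$⟩ʳ zero)) (perms-complete (remove zero π))
  where
  combine : ∀ {j ρ} → π ⟨$⟩ʳ zero ≡ j → ρ Perm.≈ remove zero π → insert zero j ρ Perm.≈ π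
  combine ≡.refl ρ≈ zero = ≡.refl
  combine {ρ = ρ} ≡.refl ρ≈ (suc i) = ≡.trans
    (≡.cong (punchIn (π ⟨$⟩ʳ zero)) (ρ≈ i))
    (insert-remove zero π (suc i))

perms-unique : ∀ n → AllPairs (λ π ρ → ¬ π Perm.≈ ρ) (perms n)
perms-unique zero    = [] ∷ []
perms-unique (suc n) = go (Unique.allFin⁺ (suc n))
  where
  insert-injectiveʳ : ∀ j {π ρ : Permutation′ n} → insert zero j π Perm.≈ insert zero j ρ → π Perm.≈ ρ
  insert-injectiveʳ j {π} {ρ} eq i = punchIn-injective j _ _ (eq (suc i))

  go : ∀ {js} → AllPairs (λ i j → ¬ i ≡ j) js →
       AllPairs (λ π ρ → ¬ π Perm.≈ ρ) (cartesianProductWith (insert zero) js (perms n))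
  go []               = []
  go {j ∷ js} (j∉js ∷ js!) = AllPairs.++⁺
    (AllPairs.map⁺ (AllPairs.map (λ {π} {ρ} ne eq → ne (insert-injectiveʳ j {π} {ρ} eq)) (perms-unique n)))
    (go js!)
    (All.map⁺ (All.universal (λ π →
      All.cartesianProductWith⁺ (≡.setoid _) (≡.setoid _) (insert zero) js (perms n)
        λ k∈js ρ∈ eq → All.lookup j∉js k∈js (eq zero)) (perms n)))

module Matrices (R : CommutativeRing c ℓ) where

  open CommutativeRing R
  open RawSemiringDefs (Semiring.rawSemiring semiring) using (product)

  Matrix : ℕ → Set c
  Matrix n = Fin n → Fin n → Carrier

  ∑Perm : ∀ n → (Permutation′ n → Carrier) → Carrier
  ∑Perm n f = List.foldr _+_ 0# (List.map f (perms n))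

  -- One factor -1 for each inversion.
  sgn : ∀ {n} → Permutation′ n → Carrier
  sgn σ = product λ i → product λ j →
    if does (i <? j ×-dec σ ⟨$⟩ʳ j <? σ ⟨$⟩ʳ i) then - 1# else 1#

  det : ∀ {n} → Matrix n → Carrier
  det {n} A = ∑Perm n λ σ → sgn σ * product λ i → A i (σ ⟨$⟩ʳ i)

  identityMatrix : ∀ n → Matrix n
  identityMatrix n i j = if does (i ≟ j) then 1# else 0#

  -- The matrix sending the j-th basis vector to the (σ j)-th one.
  permutationMatrix : ∀ {n} → Permutation′ n → Matrix n
  permutationMatrix σ i j = if does (i ≟ σ ⟨$⟩ʳ j) then 1# else 0#

fallingFactorial : ℤ → ℕ → ℤ
fallingFactorial a zero    = 1ℤ
fallingFactorial a (suc k) = fallingFactorial a k ℤ.* (a ℤ.- + k)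

-- Integer division, which is exact here.
binom : ℤ → ℕ → ℤ
binom a k = (fallingFactorial a k ℤ./ℕ (k !)) {{ℕ._!≢0 k}}

-- Series in y whose coefficients are series in x: the coefficient of
-- xᵐyⁿ in f is f n m.
ℤ⟦x⟧ ℤ⟦x,y⟧ ℚ⟦x⟧ ℚ⟦x,y⟧ : CommutativeRing 0ℓ 0ℓ
ℤ⟦x⟧   = PowerSeries.commutativeRing ℤ.+-*-commutativeRing
ℤ⟦x,y⟧ = PowerSeries.commutativeRing ℤ⟦x⟧
ℚ⟦x⟧   = PowerSeries.commutativeRing ℚ.+-*-commutativeRing
ℚ⟦x,y⟧ = PowerSeries.commutativeRing ℚ⟦x⟧

module ℤ⟦x⟧   = CommutativeRing ℤ⟦x⟧
module ℤ⟦x,y⟧ = CommutativeRing ℤ⟦x,y⟧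
module ℚ⟦x⟧   = CommutativeRing ℚ⟦x⟧
module ℚ⟦x,y⟧ = CommutativeRing ℚ⟦x,y⟧

module ℤx  = PowerSeries ℤ.+-*-commutativeRing
module ℤxy = PowerSeries ℤ⟦x⟧

ℤ⇒ℚ : ℤ⟦x,y⟧.Carrier → ℚ⟦x,y⟧.Carrier
ℤ⇒ℚ f n m = f n m ℚ./ 1

charDet : ∀ {n} → Permutation′ n → ℤ⟦x⟧.Carrier
charDet {n} σ = det λ i j →
  identityMatrix n i j ℤ⟦x⟧.- ℤx.var ℤ⟦x⟧.* permutationMatrix σ i j
  where open Matrices ℤ⟦x⟧

-- 1 + ∑ₙ₌₁^∞ ∑_σ (yⁿ / n!) det (Iₙ - x M_σ)ʳ, given by its coefficients
-- as a series in y.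
permutationSeries : ℤ → ℚ⟦x,y⟧.Carrier
permutationSeries r zero        = ℚ⟦x⟧.1#
permutationSeries r n@(suc _) m =
  (∑Perm n (λ σ → charDet σ ℤx.^ℤ r) m ℚ./ (n !)) {{ℕ._!≢0 n}}
  where open Matrices ℤ⟦x⟧

factor : ℤ → ℕ → ℤ⟦x,y⟧.Carrier
factor r k = (ℤ⟦x,y⟧.1# ℤ⟦x,y⟧.- ℤxy.var ℤ⟦x,y⟧.* ℤxy.const (ℤx.var ℤx.^ˢ k))
  ℤxy.^ℤ (ℤ.- binom (+ k ℤ.- r ℤ.- 1ℤ) k)

-- P = ∏ₖ₌₀^∞ fₖ: every coefficient of the partial products is eventually
-- constant, equal to that of P.
IsInfiniteProduct : (ℕ → ℤ⟦x,y⟧.Carrier) → ℤ⟦x,y⟧.Carrier → Set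
IsInfiniteProduct f P = ∀ n m → ∃[ K ] ∀ N → K ℕ.≤ N →
  product {N} (f ∘ toℕ) n m ≡ P n m
  where open RawSemiringDefs (Semiring.rawSemiring ℤ⟦x,y⟧.semiring) using (product)

{-# OPTIONS --safe #-}
module Submission where

open import Algebra.Bundles using (CommutativeRing; Semiring)
import Algebra.Definitions.RawSemiring as RawSemiringDefs
import Algebra.Properties.AbelianGroup as AbelianGroupProperties
import Algebra.Properties.CommutativeMonoid.Mult as MonoidMult
import Algebra.Properties.CommutativeMonoid.Sum as MonoidSum
import Algebra.Properties.CommutativeSemiring.Exp as CommutativeSemiringExp
import Algebra.Properties.Ring as RingProperties
import Algebra.Properties.Semiring.Exp as SemiringExp
import Algebra.Properties.Semiring.Mult as SemiringMult
import Algebra.Properties.Semiring.Sum as SemiringSum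
import Algebra.Solver.Ring.NaturalCoefficients.Default as SemiringSolver
open import Data.Bool.Base using (Bool; if_then_else_; _∧_)
open import Data.Fin.Base as Fin using (Fin; zero; suc; toℕ; punchIn; pinch)
open import Data.Fin.Permutation as Perm using (Permutation′; _⟨$⟩ʳ_; _⟨$⟩ˡ_; insert; remove; _∘ₚ_)
open import Data.Fin.Properties as Fin using (_≟_; _<?_; punchIn-injective; punchInᵢ≢i; toℕ≤pred[n])
open import Data.Integer.Base as ℤ using (ℤ; +_; -[1+_])
import Data.Integer.DivMod as ℤ
import Data.Integer.Properties as ℤ
import Data.Integer.Solver as ℤSolver
open import Data.List.Base as List using (List; []; _∷_; _++_; allFin; cartesianProductWith)
open import Data.List.Relation.Unary.All as All using (All; []; _∷_)
open import Data.List.Relation.Unary.AllPairs using (AllPairs; []; _∷_)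
open import Data.List.Relation.Unary.Any using (Any; here; there)
open import Data.Nat.Base as ℕ using (ℕ; zero; suc; _∸_; _!)
import Data.Nat.Properties as ℕ
open import Data.Product.Base using (_,_; ∃-syntax)
import Data.Rational.Base as ℚ
import Data.Rational.Properties as ℚ
import Data.Rational.Unnormalised.Base as ℚᵘ
open import Data.Vec.Functional using (insertAt; updateAt) renaming (_∷_ to _∷ᵛ_)
open import Data.Vec.Functional.Properties
open import Function.Base using (_∘_)
open import Function.Bundles using (mk⇔)
open import Relation.Binary.Bundles using (Setoid)
open import Relation.Binary.Core using (Rel)
open import Relation.Binary.Definitions using (Decidable; Symmetric; Transitive)
open import Relation.Binary.PropositionalEquality as ≡ using (_≡_; _≢_; _≗_)
import Relation.Binary.Reasoning.Setoid as SetoidReasoning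
open import Relation.Nullary using (¬_; does; yes; no; contradiction)
open import Relation.Nullary.Decidable using (does-⇔; dec-true; dec-false)
open import Defs

-- Contracting a letter into its image turns a sum over Sₙ₊₁ into sums over
-- Sₙ without any cycle decomposition, provided letters carry lengths: if
-- 0 is a fixed point of length a, then det (I - x M) splits off the factor
-- 1 - xᵃ, and otherwise 0 may be deleted and its length given to its image.
-- The resulting sum is symmetric in the lengths.  With q ℓ = (1 - x^ℓ)ʳ and
-- Tₐ(n) the sum for one letter of length a and n letters of length 1, this
-- reads Tₐ(n) = q a T₁(n - 1) + n Tₐ₊₁(n - 1).
-- On the other side, the logarithmic derivative y ∂_y of the k-th factor is
-- cₖ ∑_ℓ x^{kℓ} y^ℓ with cₖ = binom (k - r - 1) k, and ∑ₖ cₖ x^{kℓ} = q ℓ by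
-- the binomial series.  So the coefficients Pₙ of the product satisfy
-- n Pₙ = ∑_ℓ q ℓ Pₙ₋ℓ, whence n! ∑ᵢ q (a + i) Pₙ₋ᵢ obeys the same recursion as
-- Tₐ(n), and n! Pₙ = T₁(n - 1).  The product is handled through its partial
-- products, for which everything holds modulo a power of x.

-- All identities are cleared of n!, so that they live over integer series: the partial products
-- have integer coefficients by construction, and the permutation sum is divided by n! only at the
-- very end. Convergence is not estimated from the factors either. For n ≥ 1 and N > m, n! times the
-- coefficient of x^m y^n in the product of the first N factors equals the permutation sum, in which
-- N does not occur, and n! cancels in ℤ.
--
-- The recursion over permutations follows their enumeration by the image of 0 and a permutation of
-- the remaining letters; for the determinant the same choice is expansion along row 0. The letter
-- that absorbs 0 stands at an arbitrary position, which is why symmetry in the lengths has to be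
-- proved.
--
-- Since r may be negative, the power laws are used for series with constant term 1, and this
-- property is carried along for every determinant and every factor.

punchIn-elim : ∀ {n p} {P : Fin (suc n) → Set p} (j : Fin (suc n)) →
               P j → (∀ l → P (punchIn j l)) → ∀ l → P l
punchIn-elim {P = P} j pj pl l with j ≟ l
... | yes ≡.refl = pj
... | no  j≢l    = ≡.subst P (Fin.punchIn-punchOut j≢l) (pl (Fin.punchOut j≢l))

-- `pinch l j` is the position that column `j` occupies once column `punchIn j l` is deleted, so
-- this describes how an inserted column survives in a minor.
insertAt-punchIn-pinch : ∀ {a} {A : Set a} {n} (xs : Fin (suc n) → A) (j : Fin (suc (suc n))) l v q →
  insertAt xs j v (punchIn (punchIn j l) q) ≡ insertAt (xs ∘ punchIn l) (pinch l j) v q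
insertAt-punchIn-pinch xs zero zero v zero = ≡.refl
insertAt-punchIn-pinch xs zero (suc l) v zero = ≡.refl
insertAt-punchIn-pinch xs zero zero v (suc q) = ≡.refl
insertAt-punchIn-pinch xs zero (suc l) v (suc q) = ≡.refl
insertAt-punchIn-pinch xs (suc j) zero v q = ≡.refl
insertAt-punchIn-pinch {n = suc n} xs (suc j) (suc l) v zero = ≡.refl
insertAt-punchIn-pinch {n = suc n} xs (suc j) (suc l) v (suc q) = insertAt-punchIn-pinch (xs ∘ suc) j l v q

-- Laplace expansion of the determinant along the first row and along a column.

module Determinant {c ℓ} (R : CommutativeRing c ℓ) where

  open CommutativeRing R hiding (zero)
  open SemiringSum semiring
  open SemiringExp semiring using (_^_; ^-homo-*)
  open RawSemiringDefs (Semiring.rawSemiring semiring) using (product)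
  open RingProperties ring using (-0#≈0#; -1*x≈-x; -‿distribˡ-*; -‿distribʳ-*; -‿involutive)
  open Matrices R
  open SetoidReasoning setoid
  module Product = MonoidSum *-commutativeMonoid

  open SemiringSolver commutativeSemiring using (solve; _:=_; _:+_; _:*_)

  ∑ˡ : ∀ {a} {A : Set a} → (A → Carrier) → List A → Carrier
  ∑ˡ f xs = List.foldr _+_ 0# (List.map f xs)

  module _ {a} {A : Set a} where

    ∑ˡ-cong : ∀ {f g : A → Carrier} → (∀ x → f x ≈ g x) → ∀ xs → ∑ˡ f xs ≈ ∑ˡ g xs
    ∑ˡ-cong f≈g []       = refl
    ∑ˡ-cong f≈g (x ∷ xs) = +-cong (f≈g x) (∑ˡ-cong f≈g xs)

    ∑ˡ-distribˡ : ∀ k (f : A → Carrier) xs → ∑ˡ (λ x → k * f x) xs ≈ k * ∑ˡ f xs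
    ∑ˡ-distribˡ k f []       = sym (zeroʳ k)
    ∑ˡ-distribˡ k f (x ∷ xs) = trans (+-congˡ (∑ˡ-distribˡ k f xs)) (sym (distribˡ k _ _))

    ∑ˡ-tabulate : ∀ {n} (f : A → Carrier) (g : Fin n → A) → ∑ˡ f (List.tabulate g) ≡ ∑[ i < n ] f (g i)
    ∑ˡ-tabulate {zero}  f g = ≡.refl
    ∑ˡ-tabulate {suc n} f g = ≡.cong (_+_ (f (g zero))) (∑ˡ-tabulate f (g ∘ suc))

    ∑ˡ-map-++ : ∀ {b} {B : Set b} (f : A → Carrier) (g : B → A) xs ys →
                ∑ˡ f (List.map g xs ++ ys) ≈ ∑ˡ (f ∘ g) xs + ∑ˡ f ys
    ∑ˡ-map-++ f g []       ys = sym (+-identityˡ _)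
    ∑ˡ-map-++ f g (x ∷ xs) ys = trans (+-congˡ (∑ˡ-map-++ f g xs ys)) (sym (+-assoc _ _ _))

  ∑ˡ-cartesianProductWith : ∀ {a b d} {A : Set a} {B : Set b} {D : Set d}
    (f : D → Carrier) (g : A → B → D) xs ys →
    ∑ˡ f (cartesianProductWith g xs ys) ≈ ∑ˡ (λ x → ∑ˡ (f ∘ g x) ys) xs
  ∑ˡ-cartesianProductWith f g []       ys = refl
  ∑ˡ-cartesianProductWith f g (x ∷ xs) ys =
    trans (∑ˡ-map-++ f (g x) ys _) (+-congˡ (∑ˡ-cartesianProductWith f g xs ys))

  ∑Perm-suc : ∀ {n} (f : Permutation′ (suc n) → Carrier) →
              ∑Perm (suc n) f ≈ ∑[ j < suc n ] ∑Perm n (f ∘ insert zero j)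
  ∑Perm-suc {n} f = trans (∑ˡ-cartesianProductWith f (insert zero) (allFin (suc n)) (perms n))
    (reflexive (∑ˡ-tabulate (λ j → ∑Perm n (f ∘ insert zero j)) (λ j → j)))

  ∑-single : ∀ {n} (j : Fin n) {f : Fin n → Carrier} → (∀ l → l ≢ j → f l ≈ 0#) → ∑[ l < n ] f l ≈ f j
  ∑-single {suc n} j {f} f≈0 = begin
    ∑[ l < suc n ] f l
      ≈⟨ sum-remove {i = j} f ⟩
    f j + ∑[ l < n ] f (punchIn j l)
      ≈⟨ +-congˡ (trans (sum-cong-≋ λ l → f≈0 _ (punchInᵢ≢i j l)) (sum-replicate-zero n)) ⟩
    f j + 0#
      ≈⟨ +-identityʳ _ ⟩
    f j ∎

  alt : ℕ → Carrier
  alt n = (- 1#) ^ n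

  alt-2+ : ∀ n → alt (suc (suc n)) ≈ alt n
  alt-2+ n = trans (-1*x≈-x _) (trans (-‿cong (-1*x≈-x _)) (-‿involutive _))

  minor : ∀ {n} → Fin (suc n) → Matrix (suc n) → Matrix n
  minor j A i l = A (suc i) (punchIn j l)

  lap : ∀ {n} → Matrix n → Carrier
  lap {zero}  A = 1#
  lap {suc n} A = ∑[ j < suc n ] (alt (toℕ j) * (A zero j * lap (minor j A)))

  lap-cong : ∀ {n} {A B : Matrix n} → (∀ i j → A i j ≈ B i j) → lap A ≈ lap B
  lap-cong {zero}  A≈B = refl
  lap-cong {suc n} A≈B = sum-cong-≋ {suc n} λ j →
    *-congˡ {alt (toℕ j)} (*-cong (A≈B zero j) (lap-cong λ i l → A≈B (suc i) (punchIn j l)))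

  private
    inversion : Bool → Carrier
    inversion b = if b then - 1# else 1#

    punchIn-<? : ∀ {n} (j : Fin (suc n)) a b → does (punchIn j a <? punchIn j b) ≡ does (a <? b)
    punchIn-<? zero    a       b       = ≡.refl
    punchIn-<? (suc j) zero    zero    = ≡.refl
    punchIn-<? (suc j) zero    (suc b) = ≡.refl
    punchIn-<? (suc j) (suc a) zero    = ≡.refl
    punchIn-<? (suc j) (suc a) (suc b) = punchIn-<? j a b

    ∏-inversion-punchIn : ∀ {n} (j : Fin (suc n)) →
      product {n} (λ k → inversion (does (punchIn j k <? j))) ≈ alt (toℕ j)
    ∏-inversion-punchIn {zero}  zero    = refl
    ∏-inversion-punchIn {suc n} zero    = trans (*-identityˡ _) (∏-inversion-punchIn {n} zero)
    ∏-inversion-punchIn {suc n} (suc j) = *-congˡ (∏-inversion-punchIn j)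

  -- The value `j` at position 0 forms an inversion with each of the `toℕ j` smaller values. As
  -- `punchIn j` is increasing, the inversions among the other positions are those of `π`.
  sgn-insert : ∀ {n} (j : Fin (suc n)) (π : Permutation′ n) → sgn (insert zero j π) ≈ alt (toℕ j) * sgn π
  sgn-insert {n} j π = *-cong
    (begin
      1# * product (λ k → inversion (does (punchIn j (π ⟨$⟩ʳ k) <? j)))
        ≈⟨ *-identityˡ _ ⟩
      product (λ k → inversion (does (punchIn j (π ⟨$⟩ʳ k) <? j)))
        ≈⟨ Product.sum-permute {n} (λ k → inversion (does (punchIn j k <? j))) π ⟨
      product {n} (λ k → inversion (does (punchIn j k <? j)))
        ≈⟨ ∏-inversion-punchIn j ⟩
      alt (toℕ j) ∎)
    (Product.sum-cong-≋ {n} λ i → trans (*-identityˡ _) (Product.sum-cong-≋ {n} λ k →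
      reflexive (≡.cong (λ b → inversion (does (i <? k) ∧ b)) (punchIn-<? j (π ⟨$⟩ʳ k) (π ⟨$⟩ʳ i)))))

  det≈lap : ∀ {n} (A : Matrix n) → det A ≈ lap A
  det≈lap {zero}  A = trans (+-identityʳ _) (*-identityˡ _)
  det≈lap {suc n} A = trans
    (∑Perm-suc (λ σ → sgn σ * product λ i → A i (σ ⟨$⟩ʳ i)))
    (sum-cong-≋ {suc n} λ j → begin
      ∑Perm n (λ π → sgn (insert zero j π) * (A zero j * product λ i → A (suc i) (punchIn j (π ⟨$⟩ʳ i))))
        ≈⟨ ∑ˡ-cong (λ π → trans (*-congʳ (sgn-insert j π))
             (rearrange (alt (toℕ j)) (sgn π) (A zero j) (product λ i → A (suc i) (punchIn j (π ⟨$⟩ʳ i))))) (perms n) ⟩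
      ∑Perm n (λ π → alt (toℕ j) * A zero j * (sgn π * product λ i → A (suc i) (punchIn j (π ⟨$⟩ʳ i))))
        ≈⟨ ∑ˡ-distribˡ (alt (toℕ j) * A zero j) _ (perms n) ⟩
      alt (toℕ j) * A zero j * det (minor j A)
        ≈⟨ *-congˡ (det≈lap (minor j A)) ⟩
      alt (toℕ j) * A zero j * lap (minor j A)
        ≈⟨ *-assoc _ _ _ ⟩
      alt (toℕ j) * (A zero j * lap (minor j A)) ∎)
    where
    rearrange : ∀ a s b p → a * s * (b * p) ≈ a * b * (s * p)
    rearrange = solve 4 (λ a s b p → (a :* s :* (b :* p)) := (a :* b :* (s :* p))) refl

  -- If `l` lies below `j`, the two positions are `l` and `j - 1`; otherwise they are `l + 1` and
  -- `j`. Either way the sum has the parity of `j + l + 1`.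
  alt-punchIn-pinch : ∀ {n} (j : Fin (suc (suc n))) (l : Fin (suc n)) →
    alt (toℕ (punchIn j l) ℕ.+ toℕ (pinch l j)) ≈ alt (suc (toℕ j ℕ.+ toℕ l))
  alt-punchIn-pinch zero zero = refl
  alt-punchIn-pinch zero (suc l) = reflexive (≡.cong (λ k → alt (suc (suc k))) (ℕ.+-identityʳ (toℕ l)))
  alt-punchIn-pinch (suc j) zero =
    trans (sym (alt-2+ (toℕ j))) (reflexive (≡.cong (λ k → alt (suc (suc k))) (≡.sym (ℕ.+-identityʳ (toℕ j)))))
  alt-punchIn-pinch {suc n} (suc j) (suc l) = begin
    alt (suc (a ℕ.+ suc b))               ≡⟨ ≡.cong (λ k → alt (suc k)) (ℕ.+-suc a b) ⟩
    alt (suc (suc (a ℕ.+ b)))             ≈⟨ alt-2+ (a ℕ.+ b) ⟩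
    alt (a ℕ.+ b)                         ≈⟨ alt-punchIn-pinch j l ⟩
    alt (suc (toℕ j ℕ.+ toℕ l))           ≈⟨ alt-2+ (suc (toℕ j ℕ.+ toℕ l)) ⟨
    alt (suc (suc (suc (toℕ j ℕ.+ toℕ l)))) ≡⟨ ≡.cong (λ k → alt (suc (suc k))) (ℕ.+-suc (toℕ j) (toℕ l)) ⟨
    alt (suc (suc (toℕ j ℕ.+ suc (toℕ l)))) ∎
    where
    a = toℕ (punchIn j l)
    b = toℕ (pinch l j)

  insertCol : ∀ {n} → Fin (suc n) → (Fin (suc n) → Carrier) → (Fin (suc n) → Fin n → Carrier) → Matrix (suc n)
  insertCol j u N i = insertAt (N i) j (u i)

  -- `lap` only expands along row 0, while the contraction of a letter needs linearity in a column.
  -- Of the terms for row 0, the one for column `j` is the summand of index 0 here; every other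
  -- minor still contains the inserted column and is expanded by induction, after which the two sums
  -- are exchanged.
  lap-insertCol : ∀ {n} (j : Fin (suc n)) u N →
    lap (insertCol j u N) ≈ ∑[ i < suc n ] (alt (toℕ i ℕ.+ toℕ j) * (u i * lap (λ i′ → N (punchIn i i′))))
  lap-insertCol {zero}  zero u N = refl
  lap-insertCol {suc n} j u N = begin
    ∑[ k < suc (suc n) ] term k
      ≈⟨ sum-remove {i = j} term ⟩
    term j + ∑[ l < suc n ] term (punchIn j l)
      ≈⟨ +-cong (*-congˡ (*-cong (reflexive (insertAt-lookup (N zero) j (u zero)))
                  (lap-cong λ i l → reflexive (insertAt-punchIn (N (suc i)) j (u (suc i)) l))))
                (sum-cong-≋ expand) ⟩
    head + ∑[ l < suc n ] ∑[ i < suc n ] cell i l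
      ≈⟨ +-congˡ (∑-comm λ l i → cell i l) ⟩
    head + ∑[ i < suc n ] ∑[ l < suc n ] cell i l
      ≈⟨ +-congˡ (sum-cong-≋ λ i → collect i) ⟩
    head + ∑[ i < suc n ] (alt (suc (toℕ i ℕ.+ toℕ j)) * (u (suc i) * lap (λ i′ → N (punchIn (suc i) i′))))
      ∎
    where
    term : Fin (suc (suc n)) → Carrier
    term k = alt (toℕ k) * (insertCol j u N zero k * lap (minor k (insertCol j u N)))
    head = alt (toℕ j) * (u zero * lap (N ∘ suc))
    S : Fin (suc n) → Fin (suc n) → Carrier
    S i l = lap λ i′ l′ → N (suc (punchIn i i′)) (punchIn l l′)
    cell : Fin (suc n) → Fin (suc n) → Carrier
    cell i l = alt (suc (toℕ i ℕ.+ toℕ j)) * u (suc i) * (alt (toℕ l) * (N zero l * S i l))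

    sign : ∀ i l → alt (toℕ (punchIn j l)) * alt (toℕ i ℕ.+ toℕ (pinch l j)) ≈ alt (suc (toℕ i ℕ.+ toℕ j)) * alt (toℕ l)
    sign i l = begin
      alt k * alt (a ℕ.+ p)        ≈⟨ *-congˡ (^-homo-* (- 1#) a p) ⟩
      alt k * (alt a * alt p)      ≈⟨ swap (alt k) (alt a) (alt p) ⟩
      alt a * (alt k * alt p)      ≈⟨ *-congˡ (^-homo-* (- 1#) k p) ⟨
      alt a * alt (k ℕ.+ p)        ≈⟨ *-congˡ (alt-punchIn-pinch j l) ⟩
      alt a * alt (suc b ℕ.+ d)    ≈⟨ *-congˡ (^-homo-* (- 1#) (suc b) d) ⟩
      alt a * (- 1# * alt b * alt d) ≈⟨ shift (alt a) (- 1#) (alt b) (alt d) ⟩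
      - 1# * (alt a * alt b) * alt d ≈⟨ *-congʳ (*-congˡ (^-homo-* (- 1#) a b)) ⟨
      alt (suc (a ℕ.+ b)) * alt d  ∎
      where
      a = toℕ i
      b = toℕ j
      d = toℕ l
      k = toℕ (punchIn j l)
      p = toℕ (pinch l j)
      swap : ∀ x y z → x * (y * z) ≈ y * (x * z)
      swap = solve 3 (λ x y z → (x :* (y :* z)) := (y :* (x :* z))) refl
      shift : ∀ x y z w → x * (y * z * w) ≈ y * (x * z) * w
      shift = solve 4 (λ x y z w → (x :* (y :* z :* w)) := (y :* (x :* z) :* w)) refl

    expand : ∀ l → term (punchIn j l) ≈ ∑[ i < suc n ] cell i l
    expand l = begin
      term (punchIn j l)
        ≈⟨ *-congˡ (*-cong (reflexive (insertAt-punchIn (N zero) j (u zero) l))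
             (trans (lap-cong λ i q → reflexive (insertAt-punchIn-pinch (N (suc i)) j l (u (suc i)) q))
               (lap-insertCol (pinch l j) (u ∘ suc) (λ i q → N (suc i) (punchIn l q))))) ⟩
      alt (toℕ (punchIn j l)) * (N zero l * ∑[ i < suc n ] sub i)
        ≈⟨ *-congˡ (*-distribˡ-sum (N zero l) sub) ⟩
      alt (toℕ (punchIn j l)) * ∑[ i < suc n ] (N zero l * sub i)
        ≈⟨ *-distribˡ-sum (alt (toℕ (punchIn j l))) (λ i → N zero l * sub i) ⟩
      ∑[ i < suc n ] (alt (toℕ (punchIn j l)) * (N zero l * sub i))
        ≈⟨ sum-cong-≋ (λ i → begin
             alt (toℕ (punchIn j l)) * (N zero l * sub i)
               ≈⟨ swap₁ (alt (toℕ (punchIn j l))) (N zero l) (alt (toℕ i ℕ.+ toℕ (pinch l j))) (u (suc i)) (S i l) ⟩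
             alt (toℕ (punchIn j l)) * alt (toℕ i ℕ.+ toℕ (pinch l j)) * (u (suc i) * (N zero l * S i l))
               ≈⟨ *-congʳ (sign i l) ⟩
             alt (suc (toℕ i ℕ.+ toℕ j)) * alt (toℕ l) * (u (suc i) * (N zero l * S i l))
               ≈⟨ swap₂ (alt (suc (toℕ i ℕ.+ toℕ j))) (alt (toℕ l)) (u (suc i)) (N zero l * S i l) ⟩
             cell i l ∎) ⟩
      ∑[ i < suc n ] cell i l ∎
      where
      sub : Fin (suc n) → Carrier
      sub i = alt (toℕ i ℕ.+ toℕ (pinch l j)) * (u (suc i) * S i l)
      swap₁ : ∀ a b d e f → a * (b * (d * (e * f))) ≈ a * d * (e * (b * f))
      swap₁ = solve 5 (λ a b d e f → (a :* (b :* (d :* (e :* f)))) := (a :* d :* (e :* (b :* f)))) refl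
      swap₂ : ∀ a b d e → a * b * (d * e) ≈ a * d * (b * e)
      swap₂ = solve 4 (λ a b d e → (a :* b :* (d :* e)) := (a :* d :* (b :* e))) refl

    collect : ∀ i → ∑[ l < suc n ] cell i l ≈
              alt (suc (toℕ i ℕ.+ toℕ j)) * (u (suc i) * lap (λ i′ → N (punchIn (suc i) i′)))
    collect i = trans
      (sym (*-distribˡ-sum (alt (suc (toℕ i ℕ.+ toℕ j)) * u (suc i)) (λ l → alt (toℕ l) * (N zero l * S i l))))
      (*-assoc _ _ _)

  -- The second summand of column j is moved to column 0, hence the sign.
  lap-insertCol-+ : ∀ {n} (j : Fin (suc n)) s u v N →
    lap (insertCol j (λ i → u i + s * v i) N) ≈ lap (insertCol j u N) + s * (alt (toℕ j) * lap (insertCol zero v N))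
  lap-insertCol-+ {n} j s u v N = begin
    lap (insertCol j (λ i → u i + s * v i) N)
      ≈⟨ lap-insertCol j (λ i → u i + s * v i) N ⟩
    ∑[ i < suc n ] (alt (toℕ i ℕ.+ toℕ j) * ((u i + s * v i) * S i))
      ≈⟨ sum-cong-≋ (λ i → trans (split (alt (toℕ i ℕ.+ toℕ j)) (u i) s (v i) (S i))
           (+-congˡ (*-congˡ (trans (*-congʳ (trans (^-homo-* (- 1#) (toℕ i) (toℕ j))
             (*-congʳ (reflexive (≡.cong alt (≡.sym (ℕ.+-identityʳ (toℕ i)))))))) (move _ _ _))))) ⟩
    ∑[ i < suc n ] (f i + s * (alt (toℕ j) * g i))
      ≈⟨ ∑-distrib-+ f (λ i → s * (alt (toℕ j) * g i)) ⟩
    ∑[ i < suc n ] f i + ∑[ i < suc n ] (s * (alt (toℕ j) * g i))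
      ≈⟨ +-congˡ (trans (*-congˡ (*-distribˡ-sum (alt (toℕ j)) g)) (*-distribˡ-sum s (λ i → alt (toℕ j) * g i))) ⟨
    ∑[ i < suc n ] f i + s * (alt (toℕ j) * ∑[ i < suc n ] g i)
      ≈⟨ +-cong (lap-insertCol j u N) (*-congˡ (*-congˡ (lap-insertCol zero v N))) ⟨
    lap (insertCol j u N) + s * (alt (toℕ j) * lap (insertCol zero v N)) ∎
    where
    S : Fin (suc n) → Carrier
    S i = lap λ i′ → N (punchIn i i′)
    f g : Fin (suc n) → Carrier
    f i = alt (toℕ i ℕ.+ toℕ j) * (u i * S i)
    g i = alt (toℕ i ℕ.+ 0) * (v i * S i)
    split : ∀ a u s v t → a * ((u + s * v) * t) ≈ a * (u * t) + s * (a * (v * t))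
    split = solve 5 (λ a u s v t → (a :* ((u :+ s :* v) :* t)) := (a :* (u :* t) :+ s :* (a :* (v :* t)))) refl
    move : ∀ a b d → a * b * d ≈ b * (a * d)
    move = solve 3 (λ a b d → (a :* b :* d) := (b :* (a :* d))) refl

  δ : ∀ {n} → Matrix n
  δ {n} = identityMatrix n

  δ-≢ : ∀ {n} {i j : Fin n} → i ≢ j → δ i j ≡ 0#
  δ-≢ {i = i} {j} i≢j = ≡.cong (λ b → if b then 1# else 0#) (dec-false (i ≟ j) i≢j)

  δ-refl : ∀ {n} (i : Fin n) → δ i i ≡ 1#
  δ-refl i = ≡.cong (λ b → if b then 1# else 0#) (dec-true (i ≟ i) ≡.refl)

  δ-injective : ∀ {m n} {f : Fin m → Fin n} → (∀ {i j} → f i ≡ f j → i ≡ j) →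
                ∀ i j → δ (f i) (f j) ≡ δ i j
  δ-injective {f = f} f-inj i j =
    ≡.cong (λ b → if b then 1# else 0#) (does-⇔ (mk⇔ f-inj (≡.cong f)) (f i ≟ f j) (i ≟ j))

  -- Determinants of weighted permutation matrices under deletion of a letter.

  module CycleDeterminant (x : Carrier) where

    -- Each letter l carries the exponent w l + 1, so that a whole segment
    -- of a cycle can be represented by a single letter.
    weightedMatrix : ∀ {n} → (Fin n → ℕ) → Permutation′ n → Matrix n
    weightedMatrix w σ i l = δ i l - x ^ suc (w l) * δ (σ ⟨$⟩ʳ i) l

    weightedDet : ∀ {n} → (Fin n → ℕ) → Permutation′ n → Carrier
    weightedDet w σ = lap (weightedMatrix w σ)

    weightedDet-cong : ∀ {n} {w w′ : Fin n → ℕ} {σ τ} → w ≗ w′ → σ Perm.≈ τ → weightedDet w σ ≈ weightedDet w′ τ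
    weightedDet-cong {w = w} {w′} {σ} {τ} w≗w′ σ≈τ = 
      lap-cong {A = weightedMatrix w σ} {weightedMatrix w′ τ} λ i l → reflexive
        (≡.cong₂ (λ a j → δ i l - x ^ suc a * δ j l) (w≗w′ l) (σ≈τ i))

    weightedDet-fixed : ∀ {n} (w : Fin (suc n) → ℕ) π →
      weightedDet w (insert zero zero π) ≈ (1# - x ^ suc (w zero)) * weightedDet (w ∘ suc) π
    weightedDet-fixed {n} w π = begin
      ∑[ l < suc n ] (alt (toℕ l) * (A zero l * lap (minor l A)))
        ≈⟨ ∑-single zero off-diagonal ⟩
      1# * ((1# - x ^ suc (w zero) * 1#) * weightedDet (w ∘ suc) π)
        ≈⟨ *-identityˡ _ ⟩
      (1# - x ^ suc (w zero) * 1#) * weightedDet (w ∘ suc) π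
        ≈⟨ *-congʳ (+-congˡ (-‿cong (*-identityʳ _))) ⟩
      (1# - x ^ suc (w zero)) * weightedDet (w ∘ suc) π ∎
      where
      A = weightedMatrix w (insert zero zero π)
      off-diagonal : ∀ l → l ≢ zero → alt (toℕ l) * (A zero l * lap (minor l A)) ≈ 0#
      off-diagonal zero    l≢0 = contradiction ≡.refl l≢0
      off-diagonal (suc l) l≢0 = begin
        alt (toℕ (suc l)) * ((0# - x ^ suc (w (suc l)) * 0#) * lap (minor (suc l) A))
          ≈⟨ *-congˡ (*-congʳ (trans (+-identityˡ _) (trans (-‿cong (zeroʳ _)) -0#≈0#))) ⟩
        alt (toℕ (suc l)) * (0# * lap (minor (suc l) A))
          ≈⟨ trans (*-congˡ (zeroˡ _)) (zeroʳ _) ⟩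
        0# ∎

    -- Removing the letter 0 from its cycle and giving its weight to its
    -- image suc j.
    weightedDet-contract : ∀ {n} (w : Fin (suc (suc n)) → ℕ) (j : Fin (suc n)) π →
      weightedDet w (insert zero (suc j) π) ≈
      weightedDet (updateAt (w ∘ suc) j (ℕ._+ suc (w zero))) (π ∘ₚ insert zero j Perm.id)
    weightedDet-contract {n} w j π = begin
      lap A
        -- Row 0 has two nonzero entries, 1 in column 0 and `- a` in column `suc j`. Their minors
        -- share the columns `N` and differ in one column only, `u` or `v`, so they recombine by
        -- column linearity read backwards.
        ≈⟨ +-cong first others ⟩
      lap (insertCol j u N) + alt (suc (toℕ j)) * (- a * lap (insertCol zero v N))
        ≈⟨ +-congˡ sign ⟩
      lap (insertCol j u N) + a * (alt (toℕ j) * lap (insertCol zero v N))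
        ≈⟨ lap-insertCol-+ j a u v N ⟨
      lap (insertCol j (λ i → u i + a * v i) N)
        ≈⟨ lap-cong {A = insertCol j (λ i → u i + a * v i) N} {weightedMatrix w⁺ (π ∘ₚ c′)} (λ i → punchIn-elim j
             (trans (reflexive (insertAt-lookup (N i) j (u i + a * v i))) (merged i))
             (λ l → trans (reflexive (insertAt-punchIn (N i) j (u i + a * v i) l)) (kept i l))) ⟩
      weightedDet w⁺ (π ∘ₚ c′) ∎
      where
      A = weightedMatrix w (insert zero (suc j) π)
      w⁺ = updateAt (w ∘ suc) j (ℕ._+ suc (w zero))
      -- `c′` renames the letters: what `π` sends to the deleted letter 0 is sent on to `j`, and
      -- `suc l` becomes `punchIn j l`.
      c′ = insert zero j Perm.id
      a = x ^ suc (w (suc j))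
      b = x ^ suc (w zero)
      u v : Fin (suc n) → Carrier
      u i = δ i j
      v i = - (b * δ (π ⟨$⟩ʳ i) zero)
      N : Fin (suc n) → Fin n → Carrier
      N i l = δ i (punchIn j l) - x ^ suc (w (suc (punchIn j l))) * δ (π ⟨$⟩ʳ i) (suc l)

      0-k*0 : ∀ k → 0# - k * 0# ≈ 0#
      0-k*0 k = trans (+-identityˡ _) (trans (-‿cong (zeroʳ k)) -0#≈0#)

      first : 1# * ((1# - b * 0#) * lap (minor zero A)) ≈ lap (insertCol j u N)
      first = begin
        1# * ((1# - b * 0#) * lap (minor zero A))
          ≈⟨ *-identityˡ _ ⟩
        (1# - b * 0#) * lap (minor zero A)
          ≈⟨ *-congʳ (trans (+-congˡ (trans (-‿cong (zeroʳ b)) -0#≈0#)) (+-identityʳ _)) ⟩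
        1# * lap (minor zero A)
          ≈⟨ *-identityˡ _ ⟩
        lap (minor zero A)
          ≈⟨ lap-cong {A = minor zero A} {insertCol j u N} (λ i → punchIn-elim j
               (begin
                 δ i j - a * δ (punchIn (suc j) (π ⟨$⟩ʳ i)) (suc j)
                   -- The letter `suc j` is already the image of 0, so no remaining row has its
                   -- off-diagonal entry in this column.
                   ≈⟨ +-congˡ (-‿cong (trans (*-congˡ (reflexive (δ-≢ (punchInᵢ≢i (suc j) (π ⟨$⟩ʳ i))))) (zeroʳ a))) ⟩
                 δ i j - 0#
                   ≈⟨ trans (+-congˡ -0#≈0#) (+-identityʳ _) ⟩
                 δ i j
                   ≡⟨ insertAt-lookup (N i) j (u i) ⟨
                 insertCol j u N i j ∎)
               (λ l → begin
                 minor zero A i (punchIn j l)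
                   ≡⟨ ≡.cong (λ d → δ i (punchIn j l) - x ^ suc (w (suc (punchIn j l))) * d)
                        (δ-injective (punchIn-injective (suc j) _ _) (π ⟨$⟩ʳ i) (suc l)) ⟩
                 N i l
                   ≡⟨ insertAt-punchIn (N i) j (u i) l ⟨
                 insertCol j u N i (punchIn j l) ∎)) ⟩
        lap (insertCol j u N) ∎

      others : ∑[ l < suc n ] (alt (toℕ (suc l)) * (A zero (suc l) * lap (minor (suc l) A))) ≈
               alt (suc (toℕ j)) * (- a * lap (insertCol zero v N))
      others = begin
        ∑[ l < suc n ] (alt (toℕ (suc l)) * (A zero (suc l) * lap (minor (suc l) A)))
          ≈⟨ ∑-single j (λ l l≢j → trans
               (*-congˡ {alt (toℕ (suc l))} (trans
                 (*-congʳ {lap (minor (suc l) A)} (trans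
                   (+-congˡ (-‿cong (*-congˡ {x ^ suc (w (suc l))} (reflexive (δ-≢ (l≢j ∘ ≡.sym))))))
                   (0-k*0 _)))
                 (zeroˡ _)))
               (zeroʳ _)) ⟩
        alt (suc (toℕ j)) * ((0# - a * δ j j) * lap (minor (suc j) A))
          ≈⟨ *-congˡ (*-cong
               (trans (+-identityˡ _) (-‿cong (trans (*-congˡ (reflexive (δ-refl j))) (*-identityʳ a))))
               (lap-cong {A = minor (suc j) A} {insertCol zero v N} λ i → λ where
                 zero → trans (+-identityˡ _) (-‿cong (*-congˡ (reflexive
                   (δ-injective (punchIn-injective (suc j) _ _) (π ⟨$⟩ʳ i) zero))))
                 (suc l) → +-congˡ (-‿cong (*-congˡ (reflexive
                   (δ-injective (punchIn-injective (suc j) _ _) (π ⟨$⟩ʳ i) (suc l))))))) ⟩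
        alt (suc (toℕ j)) * (- a * lap (insertCol zero v N)) ∎

      sign : alt (suc (toℕ j)) * (- a * lap (insertCol zero v N)) ≈ a * (alt (toℕ j) * lap (insertCol zero v N))
      sign = begin
        - 1# * s * (- a * t)      ≈⟨ *-cong (-1*x≈-x s) (sym (-‿distribˡ-* a t)) ⟩
        - s * - (a * t)           ≈⟨ -‿distribˡ-* s _ ⟨
        - (s * - (a * t))         ≈⟨ -‿cong (-‿distribʳ-* s (a * t)) ⟨
        - - (s * (a * t))         ≈⟨ -‿involutive _ ⟩
        s * (a * t)               ≈⟨ solve 3 (λ s a t → s :* (a :* t) := a :* (s :* t)) refl s a t ⟩
        a * (s * t)               ∎
        where
        s = alt (toℕ j)
        t = lap (insertCol zero v N)

      c′-injective : ∀ {p q} → c′ ⟨$⟩ʳ p ≡ c′ ⟨$⟩ʳ q → p ≡ q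
      c′-injective eq = ≡.trans (≡.sym (Perm.inverseˡ c′)) (≡.trans (≡.cong (c′ ⟨$⟩ˡ_) eq) (Perm.inverseˡ c′))

      merged : ∀ i → u i + a * v i ≈ weightedMatrix w⁺ (π ∘ₚ c′) i j
      merged i = +-congˡ (begin
        a * - (b * d)                 ≈⟨ -‿distribʳ-* a (b * d) ⟨
        - (a * (b * d))               ≈⟨ -‿cong (*-assoc a b d) ⟨
        - (a * b * d)                 ≈⟨ -‿cong (*-cong (^-homo-* x (suc (w (suc j))) (suc (w zero)))
                                            (reflexive (δ-injective c′-injective (π ⟨$⟩ʳ i) zero))) ⟨
        - (x ^ suc (w (suc j) ℕ.+ suc (w zero)) * δ (c′ ⟨$⟩ʳ (π ⟨$⟩ʳ i)) j)
          ≡⟨ ≡.cong (λ k → - (x ^ suc k * δ (c′ ⟨$⟩ʳ (π ⟨$⟩ʳ i)) j)) (updateAt-updates j (w ∘ suc)) ⟨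
        - (x ^ suc (w⁺ j) * δ (c′ ⟨$⟩ʳ (π ⟨$⟩ʳ i)) j) ∎)
        where d = δ (π ⟨$⟩ʳ i) zero

      kept : ∀ i l → N i l ≈ weightedMatrix w⁺ (π ∘ₚ c′) i (punchIn j l)
      kept i l = reflexive (≡.cong₂ (λ k d → δ i (punchIn j l) - x ^ suc k * d)
        (≡.sym (updateAt-minimal (punchIn j l) j (w ∘ suc) (punchInᵢ≢i j l)))
        (≡.sym (δ-injective c′-injective (π ⟨$⟩ʳ i) (suc l))))

-- Reindexing sums over all permutations.

module PermutationSums {c ℓ} (R : CommutativeRing c ℓ) where

  open CommutativeRing R hiding (zero)
  open Determinant R
  open Matrices R
  open SemiringSolver commutativeSemiring using (solve; _:=_; _:+_)
  open SetoidReasoning setoid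

  ∑ˡ-0 : ∀ {a} {A : Set a} {f : A → Carrier} {xs} → All (λ x → f x ≈ 0#) xs → ∑ˡ f xs ≈ 0#
  ∑ˡ-0 []            = refl
  ∑ˡ-0 (fx≈0 ∷ f≈0) = trans (+-cong fx≈0 (∑ˡ-0 f≈0)) (+-identityˡ 0#)

  ∑ˡ-distrib-+ : ∀ {a} {A : Set a} (f g : A → Carrier) xs → ∑ˡ (λ x → f x + g x) xs ≈ ∑ˡ f xs + ∑ˡ g xs
  ∑ˡ-distrib-+ f g []       = sym (+-identityˡ 0#)
  ∑ˡ-distrib-+ f g (x ∷ xs) = trans (+-congˡ (∑ˡ-distrib-+ f g xs))
    (solve 4 (λ a b s t → a :+ b :+ (s :+ t) := a :+ s :+ (b :+ t)) refl (f x) (g x) (∑ˡ f xs) (∑ˡ g xs))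

  ∑ˡ-comm : ∀ {a b} {A : Set a} {B : Set b} (f : A → B → Carrier) xs ys →
            ∑ˡ (λ x → ∑ˡ (f x) ys) xs ≈ ∑ˡ (λ y → ∑ˡ (λ x → f x y) xs) ys
  ∑ˡ-comm f []       ys = sym (∑ˡ-0 (All.universal (λ _ → refl) ys))
  ∑ˡ-comm f (x ∷ xs) ys = trans (+-congˡ (∑ˡ-comm f xs ys)) (sym (∑ˡ-distrib-+ (f x) _ ys))

  module _ {a r} {A : Set a} {_∼_ : Rel A r} (∼-sym : Symmetric _∼_) (∼-trans : Transitive _∼_)
           (_∼?_ : Decidable _∼_) {f : A → Carrier} (f-cong : ∀ {x y} → x ∼ y → f x ≈ f y) where

    restrict : A → A → Carrier
    restrict z x = if does (x ∼? z) then f x else 0#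

    restrict-∼ : ∀ {x z} → x ∼ z → restrict z x ≈ f z
    restrict-∼ {x} {z} x∼z rewrite dec-true (x ∼? z) x∼z = f-cong x∼z

    restrict-≁ : ∀ {x z} → ¬ x ∼ z → restrict z x ≈ 0#
    restrict-≁ {x} {z} x≁z rewrite dec-false (x ∼? z) x≁z = refl

    -- The two hypotheses say that exactly one entry of the list is equivalent to `z`. Permutations
    -- are compared only up to pointwise equality, so indicator sums replace any matching of lists.
    ∑ˡ-restrict : ∀ {z xs} → AllPairs (λ x y → ¬ x ∼ y) xs → Any (_∼ z) xs → ∑ˡ (restrict z) xs ≈ f z
    ∑ˡ-restrict (x≁ ∷ _) (here x∼z) = trans
      (+-cong (restrict-∼ x∼z) (∑ˡ-0 (All.map (λ x≁y → restrict-≁ λ y∼z → x≁y (∼-trans x∼z (∼-sym y∼z))) x≁)))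
      (+-identityʳ _)
    ∑ˡ-restrict (x≁ ∷ xs!) (there z∈xs) = trans
      (+-cong (restrict-≁ λ x∼z → let x≁y , y∼z = All.lookupAny x≁ z∈xs in x≁y (∼-trans x∼z (∼-sym y∼z)))
              (∑ˡ-restrict xs! z∈xs))
      (+-identityˡ _)

  -- Both sides equal the double sum of the f τ over the pairs with τ ≈ φ σ.
  ∑Perm-bijection : ∀ {n} {f : Permutation′ n → Carrier} → (∀ {σ τ} → σ Perm.≈ τ → f σ ≈ f τ) →
    (φ ψ : Permutation′ n → Permutation′ n) →
    (∀ {σ τ} → τ Perm.≈ φ σ → σ Perm.≈ ψ τ) → (∀ {σ τ} → σ Perm.≈ ψ τ → τ Perm.≈ φ σ) →
    ∑Perm n (f ∘ φ) ≈ ∑Perm n f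
  ∑Perm-bijection {n} {f} f-cong φ ψ to from = begin
    ∑ˡ (f ∘ φ) ps
      ≈⟨ ∑ˡ-cong (λ σ → ∑ˡ-restrict (λ {σ τ} → ∼-sym {σ} {τ}) (λ {σ τ υ} → ∼-trans {σ} {τ} {υ}) _≈?_
           {f} (λ {σ τ} → f-cong {σ} {τ}) {φ σ} (perms-unique n) (perms-complete (φ σ))) ps ⟨
    ∑ˡ (λ σ → ∑ˡ (λ τ → if does (τ ≈? φ σ) then f τ else 0#) ps) ps
      ≈⟨ ∑ˡ-comm (λ σ τ → if does (τ ≈? φ σ) then f τ else 0#) ps ps ⟩
    ∑ˡ (λ τ → ∑ˡ (λ σ → if does (τ ≈? φ σ) then f τ else 0#) ps) ps
      ≈⟨ ∑ˡ-cong (λ τ → ∑ˡ-cong (λ σ → reflexive (≡.cong (λ b → if b then f τ else 0#)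
           (does-⇔ (mk⇔ (to {σ} {τ}) from) (τ ≈? φ σ) (σ ≈? ψ τ)))) ps) ps ⟩
    ∑ˡ (λ τ → ∑ˡ (λ σ → if does (σ ≈? ψ τ) then f τ else 0#) ps) ps
      ≈⟨ ∑ˡ-cong (λ τ → ∑ˡ-restrict (λ {σ τ} → ∼-sym {σ} {τ}) (λ {σ τ υ} → ∼-trans {σ} {τ} {υ}) _≈?_
           {λ _ → f τ} (λ _ → refl) {ψ τ} (perms-unique n) (perms-complete (ψ τ))) ps ⟩
    ∑ˡ f ps ∎
    where
    ps = perms n
    _≈?_ : Decidable {A = Permutation′ n} Perm._≈_
    σ ≈? τ = Fin.all? λ i → (σ ⟨$⟩ʳ i) ≟ (τ ⟨$⟩ʳ i)
    ∼-sym : Symmetric {A = Permutation′ n} Perm._≈_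
    ∼-sym σ≈τ i = ≡.sym (σ≈τ i)
    ∼-trans : Transitive {A = Permutation′ n} Perm._≈_
    ∼-trans σ≈τ τ≈υ i = ≡.trans (σ≈τ i) (τ≈υ i)

-- Cycle sums of weighted letters and their symmetry.

module CycleSums {c ℓ} (R : CommutativeRing c ℓ) (q : ℕ → CommutativeRing.Carrier R) where

  open CommutativeRing R hiding (zero)
  open SemiringSum semiring
  open SemiringMult semiring using (_×_)
  open SemiringSolver commutativeSemiring using (solve; _:=_; _:+_; _:*_)
  open SetoidReasoning setoid

  absorb : ∀ {n} → ℕ → (Fin n → ℕ) → Fin n → Fin n → ℕ
  absorb a w j = updateAt w j (ℕ._+ suc a)

  -- The sum over all permutations of n letters of the product of the
  -- q (total weight) over the cycles, a letter of weight w having length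
  -- w + 1: the letter 0 is either a fixed point or absorbed by its image.
  cycleSum : ∀ {n} → (Fin n → ℕ) → Carrier
  cycleSum {zero}  w = 1#
  cycleSum {suc n} w = q (w zero) * cycleSum (w ∘ suc) + ∑[ j < n ] cycleSum (absorb (w zero) (w ∘ suc) j)

  absorb-cong : ∀ {n a} {w w′ : Fin n → ℕ} → w ≗ w′ → ∀ j → absorb a w j ≗ absorb a w′ j
  absorb-cong {a = a} {w} {w′} w≗w′ j i with i ≟ j
  ... | yes ≡.refl = ≡.trans (updateAt-updates i w)
                       (≡.trans (≡.cong (ℕ._+ suc a) (w≗w′ i)) (≡.sym (updateAt-updates i w′)))
  ... | no i≢j     = ≡.trans (updateAt-minimal i j w i≢j)
                       (≡.trans (w≗w′ i) (≡.sym (updateAt-minimal i j w′ i≢j)))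

  cycleSum-cong : ∀ {n} (w w′ : Fin n → ℕ) → w ≗ w′ → cycleSum w ≈ cycleSum w′
  cycleSum-cong {zero}  w w′ w≗w′ = refl
  cycleSum-cong {suc n} w w′ w≗w′ = +-cong
    (*-cong (reflexive (≡.cong q (w≗w′ zero))) (cycleSum-cong (w ∘ suc) (w′ ∘ suc) (w≗w′ ∘ suc)))
    (sum-cong-≋ {n} λ j →
      cycleSum-cong (absorb (w zero) (w ∘ suc) j) (absorb (w′ zero) (w′ ∘ suc) j) λ i → ≡.trans
        (≡.cong (λ a → absorb a (w ∘ suc) j i) (w≗w′ zero))
        (absorb-cong (w≗w′ ∘ suc) j i))

  absorb-comm : ∀ {n} a b (w : Fin n → ℕ) k l → absorb a (absorb b w l) k ≗ absorb b (absorb a w k) l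
  absorb-comm a b w k l i with k ≟ l
  ... | no  k≢l    = ≡.sym (updateAt-commutes l k (k≢l ∘ ≡.sym) w i)
  ... | yes ≡.refl = ≡.trans (updateAt-updateAt k w i) (≡.trans
    (updateAt-cong k (λ m → ≡.trans (ℕ.+-assoc m (suc b) (suc a)) (≡.trans
      (≡.cong (m ℕ.+_) (ℕ.+-comm (suc b) (suc a))) (≡.sym (ℕ.+-assoc m (suc a) (suc b))))) w i)
    (≡.sym (updateAt-updateAt k w i)))

  -- Expanding both letters leaves five kinds of terms: both closed as cycles, only the first or
  -- only the second closed while the other is absorbed by `w`, the two merged, and both absorbed by
  -- `w`. The exchange swaps the second and third kinds and preserves the others.
  cycleSum-swap : ∀ {n} a b (w : Fin n → ℕ) → cycleSum (a ∷ᵛ b ∷ᵛ w) ≈ cycleSum (b ∷ᵛ a ∷ᵛ w)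
  cycleSum-swap {n} a b w = begin
    cycleSum (a ∷ᵛ b ∷ᵛ w)
      ≈⟨ expand a b ⟩
    q a * (q b * cycleSum w + X b) + (cycleSum ((b ℕ.+ suc a) ∷ᵛ w) + (q b * X a + Y b a))
      ≈⟨ +-congˡ (+-cong (cycleSum-cong ((b ℕ.+ suc a) ∷ᵛ w) ((a ℕ.+ suc b) ∷ᵛ w) λ where
             zero    → ≡.trans (ℕ.+-suc b a) (≡.trans (≡.cong suc (ℕ.+-comm b a)) (≡.sym (ℕ.+-suc a b)))
             (suc i) → ≡.refl)
           (+-congˡ Y-comm)) ⟩
    q a * (q b * cycleSum w + X b) + (cycleSum ((a ℕ.+ suc b) ∷ᵛ w) + (q b * X a + Y a b))
      ≈⟨ solve 7 (λ p r h x z m y → p :* (r :* h :+ x) :+ (m :+ (r :* z :+ y)) :=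
                                    r :* (p :* h :+ z) :+ (m :+ (p :* x :+ y))) refl
           (q a) (q b) (cycleSum w) (X b) (X a) (cycleSum ((a ℕ.+ suc b) ∷ᵛ w)) (Y a b) ⟩
    q b * (q a * cycleSum w + X a) + (cycleSum ((a ℕ.+ suc b) ∷ᵛ w) + (q a * X b + Y a b))
      ≈⟨ expand b a ⟨
    cycleSum (b ∷ᵛ a ∷ᵛ w) ∎
    where
    X : ℕ → Carrier
    X b = ∑[ k < n ] cycleSum (absorb b w k)
    Y : ℕ → ℕ → Carrier
    Y b a = ∑[ l < n ] ∑[ k < n ] cycleSum (absorb b (absorb a w l) k)

    Y-comm : Y b a ≈ Y a b
    Y-comm = trans (∑-comm {n} {n} λ l k → cycleSum (absorb b (absorb a w l) k))
      (sum-cong-≋ {n} λ k → sum-cong-≋ {n} λ l →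
        cycleSum-cong (absorb b (absorb a w l) k) (absorb a (absorb b w k) l) (absorb-comm b a w k l))

    expand : ∀ a b → cycleSum (a ∷ᵛ b ∷ᵛ w) ≈
             q a * (q b * cycleSum w + X b) + (cycleSum ((b ℕ.+ suc a) ∷ᵛ w) + (q b * X a + Y b a))
    expand a b = +-congˡ (+-cong
      (cycleSum-cong (absorb a (b ∷ᵛ w) zero) ((b ℕ.+ suc a) ∷ᵛ w) (∷-cong ≡.refl λ _ → ≡.refl))
      (trans (∑-distrib-+ {n} (λ l → q b * cycleSum (absorb a w l))
                              (λ l → ∑[ k < n ] cycleSum (absorb b (absorb a w l) k)))
             (+-congʳ (sym (*-distribˡ-sum {n} (q b) (λ l → cycleSum (absorb a w l)))))))

  -- The only form of symmetry that is needed: an absorption enlarges a letter at an arbitrary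
  -- position `j`, whereas the recursion acts on the front letter.
  cycleSum-insertAt : ∀ {n} (w : Fin n → ℕ) j a → cycleSum (insertAt w j a) ≈ cycleSum (a ∷ᵛ w)
  cycleSum-insertAt w zero a = cycleSum-cong (insertAt w zero a) (a ∷ᵛ w) (∷-cong ≡.refl λ _ → ≡.refl)
  cycleSum-insertAt {suc n} w (suc j) a = begin
    cycleSum (insertAt w (suc j) a)
      ≈⟨ +-cong (*-congˡ (cycleSum-insertAt w′ j a)) (begin
           ∑[ k < suc n ] cycleSum (absorb b (insertAt w′ j a) k)
             ≈⟨ sum-remove {i = j} (λ k → cycleSum (absorb b (insertAt w′ j a) k)) ⟩
           cycleSum (absorb b (insertAt w′ j a) j) + ∑[ l < n ] cycleSum (absorb b (insertAt w′ j a) (punchIn j l))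
             ≈⟨ +-cong
                  (trans (cycleSum-cong (absorb b (insertAt w′ j a) j) (insertAt w′ j (a ℕ.+ suc b)) (absorb-insertAt j))
                         (cycleSum-insertAt w′ j (a ℕ.+ suc b)))
                  (sum-cong-≋ {n} λ l → trans
                    (cycleSum-cong (absorb b (insertAt w′ j a) (punchIn j l)) (insertAt (absorb b w′ l) j a)
                      (absorb-insertAt-punchIn j l))
                    (cycleSum-insertAt (absorb b w′ l) j a)) ⟩
           cycleSum ((a ℕ.+ suc b) ∷ᵛ w′) + ∑[ l < n ] cycleSum (a ∷ᵛ absorb b w′ l) ∎) ⟩
    q b * cycleSum (a ∷ᵛ w′) + (cycleSum ((a ℕ.+ suc b) ∷ᵛ w′) + ∑[ l < n ] cycleSum (a ∷ᵛ absorb b w′ l))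
      ≈⟨ +-congˡ (+-cong
           (cycleSum-cong ((a ℕ.+ suc b) ∷ᵛ w′) (absorb b (a ∷ᵛ w′) zero) (∷-cong ≡.refl λ _ → ≡.refl))
           (sum-cong-≋ {n} λ l →
             cycleSum-cong (a ∷ᵛ absorb b w′ l) (absorb b (a ∷ᵛ w′) (suc l)) (∷-cong ≡.refl λ _ → ≡.refl))) ⟩
    cycleSum (b ∷ᵛ a ∷ᵛ w′)
      ≈⟨ cycleSum-swap b a w′ ⟩
    cycleSum (a ∷ᵛ b ∷ᵛ w′)
      ≈⟨ cycleSum-cong (a ∷ᵛ b ∷ᵛ w′) (a ∷ᵛ w) (∷-cong ≡.refl (∷-cong ≡.refl λ _ → ≡.refl)) ⟩
    cycleSum (a ∷ᵛ w) ∎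
    where
    b = w zero
    w′ = w ∘ suc

    absorb-insertAt : ∀ j → absorb b (insertAt w′ j a) j ≗ insertAt w′ j (a ℕ.+ suc b)
    absorb-insertAt j = punchIn-elim j
      (≡.trans (updateAt-updates j _) (≡.trans (≡.cong (ℕ._+ suc b) (insertAt-lookup w′ j a))
        (≡.sym (insertAt-lookup w′ j _))))
      λ l → ≡.trans (updateAt-minimal (punchIn j l) j _ (punchInᵢ≢i j l))
        (≡.trans (insertAt-punchIn w′ j a l) (≡.sym (insertAt-punchIn w′ j _ l)))

    absorb-insertAt-punchIn : ∀ j l → absorb b (insertAt w′ j a) (punchIn j l) ≗ insertAt (absorb b w′ l) j a
    absorb-insertAt-punchIn j l = punchIn-elim j
      (≡.trans (updateAt-minimal j (punchIn j l) _ (punchInᵢ≢i j l ∘ ≡.sym))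
        (≡.trans (insertAt-lookup w′ j a) (≡.sym (insertAt-lookup (absorb b w′ l) j a))))
      λ i → ≡.trans (at i) (≡.sym (insertAt-punchIn (absorb b w′ l) j a i))
      where
      at : ∀ i → absorb b (insertAt w′ j a) (punchIn j l) (punchIn j i) ≡ absorb b w′ l i
      at i with i ≟ l
      ... | yes ≡.refl = ≡.trans (updateAt-updates (punchIn j i) _)
        (≡.trans (≡.cong (ℕ._+ suc b) (insertAt-punchIn w′ j a i)) (≡.sym (updateAt-updates i w′)))
      ... | no i≢l = ≡.trans (updateAt-minimal (punchIn j i) (punchIn j l) _ (i≢l ∘ Fin.punchIn-injective j i l))
        (≡.trans (insertAt-punchIn w′ j a i) (≡.sym (updateAt-minimal i l w′ i≢l)))

  -- One letter of length a + 1 and n letters of length 1.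
  hookSum : ℕ → ℕ → Carrier
  hookSum a zero    = q a
  hookSum a (suc n) = q a * hookSum 0 n + suc n × hookSum (suc a) n

  cycleSum-hook : ∀ a n → cycleSum (a ∷ᵛ λ (_ : Fin n) → 0) ≈ hookSum a n
  cycleSum-hook a zero    = trans (+-identityʳ _) (*-identityʳ _)
  cycleSum-hook a (suc n) = +-cong
    (*-congˡ (trans (cycleSum-cong {suc n} (λ _ → 0) (0 ∷ᵛ λ _ → 0) (∷-cong ≡.refl λ _ → ≡.refl))
                    (cycleSum-hook 0 n)))
    (begin
      ∑[ j < suc n ] cycleSum (absorb a (λ _ → 0) j)
        ≈⟨ sum-cong-≋ {suc n} (λ j → trans
             (cycleSum-cong (absorb a (λ _ → 0) j) (insertAt (λ _ → 0) j (suc a)) (punchIn-elim j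
             (≡.trans (updateAt-updates j (λ _ → 0)) (≡.sym (insertAt-lookup (λ _ → 0) j (suc a))))
             λ l → ≡.trans (updateAt-minimal (punchIn j l) j (λ _ → 0) (punchInᵢ≢i j l))
                     (≡.sym (insertAt-punchIn (λ _ → 0) j (suc a) l))))
             (trans (cycleSum-insertAt (λ _ → 0) j (suc a)) (cycleSum-hook (suc a) n))) ⟩
      ∑[ j < suc n ] hookSum (suc a) n
        ≈⟨ sum-replicate (suc n) ⟩
      suc n × hookSum (suc a) n ∎)

-- Integer powers of series with constant term 1.

module SeriesPowers {c ℓ} (R : CommutativeRing c ℓ) where

  open PowerSeries R
  module R = CommutativeRing R
  open CommutativeRing commutativeRing hiding (zero)
  open CommutativeSemiringExp commutativeSemiring using (_^_; ^-congˡ; ^-distrib-*)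
  open RawSemiringDefs (Semiring.rawSemiring semiring) using (product)
  open SemiringSolver commutativeSemiring using (solve; _:=_; _:*_)
  open SetoidReasoning setoid

  ⊛-constantTerm : ∀ {f g} → f 0 R.≈ R.1# → g 0 R.≈ R.1# → (f * g) 0 R.≈ R.1#
  ⊛-constantTerm f₀ g₀ = R.trans (R.+-identityʳ _) (R.trans (R.*-cong f₀ g₀) (R.*-identityˡ _))

  inv-cancelʳ : ∀ {f} g → f 0 R.≈ R.1# → f * (inv f * g) ≈ g
  inv-cancelʳ {f} g f₀ = begin
    f * (inv f * g)  ≈⟨ *-assoc f (inv f) g ⟨
    f * inv f * g    ≈⟨ *-congʳ {g} {f * inv f} {1#} (inv-inverseʳ f f₀) ⟩
    1# * g           ≈⟨ *-identityˡ g ⟩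
    g                ∎

  inv-cancelˡ : ∀ {f} g → f 0 R.≈ R.1# → inv f * (f * g) ≈ g
  inv-cancelˡ {f} g f₀ = begin
    inv f * (f * g)  ≈⟨ solve 3 (λ x f g → x :* (f :* g) := f :* (x :* g)) refl (inv f) f g ⟩
    f * (inv f * g)  ≈⟨ inv-cancelʳ g f₀ ⟩
    g                ∎

  inv-unique : ∀ {f g} → f 0 R.≈ R.1# → f * g ≈ 1# → g ≈ inv f
  inv-unique {f} {g} f₀ fg≈1 = begin
    g                ≈⟨ inv-cancelˡ g f₀ ⟨
    inv f * (f * g)  ≈⟨ *-congˡ {inv f} {f * g} {1#} fg≈1 ⟩
    inv f * 1#       ≈⟨ *-identityʳ (inv f) ⟩
    inv f            ∎

  inv-cong : ∀ {f g} → f 0 R.≈ R.1# → f ≈ g → inv f ≈ inv g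
  inv-cong {f} {g} f₀ f≈g = inv-unique (R.trans (R.sym (f≈g 0)) f₀)
    (trans (*-congʳ {inv f} {g} {f} (sym f≈g)) (inv-inverseʳ f f₀))

  inv-distrib-* : ∀ {f g} → f 0 R.≈ R.1# → g 0 R.≈ R.1# → inv (f * g) ≈ inv f * inv g
  inv-distrib-* {f} {g} f₀ g₀ = sym (inv-unique (⊛-constantTerm {f} {g} f₀ g₀) (begin
    f * g * (inv f * inv g)
      ≈⟨ solve 4 (λ f g x y → f :* g :* (x :* y) := f :* x :* (g :* y)) refl f g (inv f) (inv g) ⟩
    f * inv f * (g * inv g)
      ≈⟨ *-cong {f * inv f} {1#} {g * inv g} {1#} (inv-inverseʳ f f₀) (inv-inverseʳ g g₀) ⟩
    1# * 1#
      ≈⟨ *-identityˡ 1# ⟩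
    1# ∎))

  ^ℤ-cong : ∀ r {f g} → f 0 R.≈ R.1# → f ≈ g → f ^ℤ r ≈ g ^ℤ r
  ^ℤ-cong (+ n)    {f} {g} f₀ f≈g = ^-congˡ n {f} {g} f≈g
  ^ℤ-cong -[1+ n ] {f} {g} f₀ f≈g = ^-congˡ (suc n) {inv f} {inv g} (inv-cong f₀ f≈g)

  ^ℤ-distrib-* : ∀ r {f g} → f 0 R.≈ R.1# → g 0 R.≈ R.1# → (f * g) ^ℤ r ≈ f ^ℤ r * g ^ℤ r
  ^ℤ-distrib-* (+ n)    {f} {g} f₀ g₀ = ^-distrib-* f g n
  ^ℤ-distrib-* -[1+ n ] {f} {g} f₀ g₀ =
    trans (^-congˡ (suc n) {inv (f * g)} {inv f * inv g} (inv-distrib-* f₀ g₀)) (^-distrib-* (inv f) (inv g) (suc n))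

  1^ : ∀ n → 1# ^ n ≈ 1#
  1^ zero    = refl
  1^ (suc n) = trans (*-identityˡ (1# ^ n)) (1^ n)

  1^ℤ : ∀ r → 1# ^ℤ r ≈ 1#
  1^ℤ (+ n)    = 1^ n
  1^ℤ -[1+ n ] = trans 
    (^-congˡ (suc n) {inv 1#} {1#} (sym (inv-unique {1#} {1#} R.refl (*-identityˡ 1#)))) (1^ (suc n))

  ^-constantTerm : ∀ n {f} → f 0 R.≈ R.1# → (f ^ n) 0 R.≈ R.1#
  ^-constantTerm zero        f₀ = R.refl
  ^-constantTerm (suc n) {f} f₀ = ⊛-constantTerm {f} {f ^ n} f₀ (^-constantTerm n f₀)

  ^ℤ-constantTerm : ∀ r {f} → f 0 R.≈ R.1# → (f ^ℤ r) 0 R.≈ R.1#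
  ^ℤ-constantTerm (+ n)        f₀ = ^-constantTerm n f₀
  -- In degree 0 the geometric series defining `inv f` consists of the term `k = 0` alone, so its
  -- constant term computes to `1# + 0#`.
  ^ℤ-constantTerm -[1+ n ] {f} f₀ = ^-constantTerm (suc n) {inv f} (R.+-identityʳ R.1#)

  product-constantTerm : ∀ N {f : Fin N → Series} → (∀ k → f k 0 R.≈ R.1#) → product f 0 R.≈ R.1#
  product-constantTerm zero        f₀ = R.refl
  product-constantTerm (suc N) {f} f₀ =
    ⊛-constantTerm {f zero} {product (f ∘ suc)} (f₀ zero) (product-constantTerm N (f₀ ∘ suc))

-- Sums of powers of determinants over the symmetric group.

module PermutationPowerSums {c ℓ} (R : CommutativeRing c ℓ) (r : ℤ) where

  open PowerSeries R
  module R = CommutativeRing R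
  open CommutativeRing commutativeRing hiding (zero)
  open SemiringSum semiring
  open RawSemiringDefs (Semiring.rawSemiring semiring) using (_^_)
  open RingProperties R.ring using (-0#≈0#)
  open SeriesPowers R using (⊛-constantTerm; ^ℤ-cong; ^ℤ-distrib-*; 1^ℤ)
  open Determinant commutativeRing
  open CycleDeterminant var
  open Matrices commutativeRing
  open PermutationSums commutativeRing
  open SetoidReasoning setoid

  cyclePower : ℕ → Series
  cyclePower a = (1# - var ^ suc a) ^ℤ r

  open CycleSums commutativeRing cyclePower

  1-var^-constantTerm : ∀ a → (1# - var ^ suc a) 0 R.≈ R.1#
  1-var^-constantTerm a = R.trans
    (R.+-congˡ (R.trans (R.-‿cong (R.trans (R.+-identityʳ _) (R.zeroˡ _))) -0#≈0#))
    (R.+-identityʳ R.1#)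

  -- This licenses the laws of `_^ℤ_` for negative `r`. Every permutation has the form
  -- `insert zero j π` up to pointwise equality, and the fixed-point and contraction formulas both
  -- reduce to fewer letters.
  weightedDet-constantTerm : ∀ {n} (w : Fin n → ℕ) σ → weightedDet w σ 0 R.≈ R.1#
  weightedDet-insert-constantTerm : ∀ {n} (w : Fin (suc n) → ℕ) j π → weightedDet w (insert zero j π) 0 R.≈ R.1#

  weightedDet-constantTerm {zero}  w σ = R.refl
  weightedDet-constantTerm {suc n} w σ = R.trans
    (weightedDet-cong {w = w} {w} {σ} {insert zero (σ ⟨$⟩ʳ zero) (remove zero σ)}
      (λ _ → ≡.refl) (λ i → ≡.sym (Perm.insert-remove zero σ i)) 0)
    (weightedDet-insert-constantTerm w (σ ⟨$⟩ʳ zero) (remove zero σ))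

  weightedDet-insert-constantTerm w zero π = R.trans (weightedDet-fixed w π 0)
    (⊛-constantTerm {1# - var ^ suc (w zero)} {weightedDet (w ∘ suc) π}
      (1-var^-constantTerm (w zero)) (weightedDet-constantTerm (w ∘ suc) π))
  weightedDet-insert-constantTerm {suc n} w (suc j) π = R.trans (weightedDet-contract w j π 0)
    (weightedDet-constantTerm (absorb (w zero) (w ∘ suc) j) (π ∘ₚ insert zero j Perm.id))

  weightedDetPower : ∀ {n} → (Fin n → ℕ) → Permutation′ n → Series
  weightedDetPower w σ = weightedDet w σ ^ℤ r

  weightedDetPower-cong : ∀ {n} (w : Fin n → ℕ) {σ τ} → σ Perm.≈ τ → weightedDetPower w σ ≈ weightedDetPower w τ
  weightedDetPower-cong w {σ} {τ} σ≈τ = ^ℤ-cong r (weightedDet-constantTerm w σ)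
    (weightedDet-cong {w = w} {w} {σ} {τ} (λ _ → ≡.refl) σ≈τ)

  ∑Perm-weightedDetPower : ∀ {n} (w : Fin n → ℕ) → ∑Perm n (weightedDetPower w) ≈ cycleSum w
  ∑Perm-weightedDetPower {zero}  w = trans (+-identityʳ (1# ^ℤ r)) (1^ℤ r)
  ∑Perm-weightedDetPower {suc n} w = begin
    ∑Perm (suc n) (weightedDetPower w)
      ≈⟨ ∑Perm-suc (weightedDetPower w) ⟩
    ∑Perm n (weightedDetPower w ∘ insert zero zero) +
      ∑[ j < n ] ∑Perm n (weightedDetPower w ∘ insert zero (suc j))
      ≈⟨ +-cong {∑Perm n (weightedDetPower w ∘ insert zero zero)} {cyclePower (w zero) * cycleSum (w ∘ suc)}
           {∑[ j < n ] ∑Perm n (weightedDetPower w ∘ insert zero (suc j))}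
           {∑[ j < n ] cycleSum (absorb (w zero) (w ∘ suc) j)}
           fixed (sum-cong-≋ {n} (absorbed w)) ⟩
    cycleSum w ∎
    where
    fixed : ∑Perm n (weightedDetPower w ∘ insert zero zero) ≈ cyclePower (w zero) * cycleSum (w ∘ suc)
    fixed = begin
      ∑Perm n (weightedDetPower w ∘ insert zero zero)
        ≈⟨ ∑ˡ-cong (λ π → trans
             (^ℤ-cong r (weightedDet-insert-constantTerm w zero π) (weightedDet-fixed w π))
             (^ℤ-distrib-* r (1-var^-constantTerm (w zero)) (weightedDet-constantTerm (w ∘ suc) π))) (perms n) ⟩
      ∑ˡ (λ π → cyclePower (w zero) * weightedDetPower (w ∘ suc) π) (perms n)
        ≈⟨ ∑ˡ-distribˡ (cyclePower (w zero)) (weightedDetPower (w ∘ suc)) (perms n) ⟩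
      cyclePower (w zero) * ∑Perm n (weightedDetPower (w ∘ suc))
        ≈⟨ *-congˡ {cyclePower (w zero)} {∑Perm n (weightedDetPower (w ∘ suc))} {cycleSum (w ∘ suc)}
             (∑Perm-weightedDetPower (w ∘ suc)) ⟩
      cyclePower (w zero) * cycleSum (w ∘ suc) ∎

    -- Quantified over its own `n`, so that `n` can be matched as a successor, the only case in
    -- which a letter `j` exists.
    absorbed : ∀ {n} (w : Fin (suc n) → ℕ) j →
      ∑Perm n (weightedDetPower w ∘ insert zero (suc j)) ≈ cycleSum (absorb (w zero) (w ∘ suc) j)
    absorbed {suc n} w j = begin
      ∑Perm (suc n) (weightedDetPower w ∘ insert zero (suc j))
        ≈⟨ ∑ˡ-cong (λ π → ^ℤ-cong r (weightedDet-insert-constantTerm w (suc j) π)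
             (weightedDet-contract w j π)) (perms (suc n)) ⟩
      ∑Perm (suc n) (weightedDetPower w⁺ ∘ (_∘ₚ move))
        -- Composition with the fixed permutation `move` is a bijection, so the renaming caused by
        -- the contraction disappears from the sum.
        ≈⟨ ∑Perm-bijection {f = weightedDetPower w⁺} (λ {σ} {τ} → weightedDetPower-cong w⁺ {σ} {τ})
             (_∘ₚ move) (_∘ₚ Perm.flip move)
             (λ τ≈ i → ≡.trans (≡.sym (Perm.inverseˡ move)) (≡.cong (move ⟨$⟩ˡ_) (≡.sym (τ≈ i))))
             (λ σ≈ i → ≡.trans (≡.sym (Perm.inverseʳ move)) (≡.cong (move ⟨$⟩ʳ_) (≡.sym (σ≈ i)))) ⟩
      ∑Perm (suc n) (weightedDetPower w⁺)
        ≈⟨ ∑Perm-weightedDetPower w⁺ ⟩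
      cycleSum w⁺ ∎
      where
      w⁺ = absorb (w zero) (w ∘ suc) j
      move = insert zero j Perm.id

  permutationDet : ∀ {n} → Permutation′ n → Series
  permutationDet {n} σ = det λ i j → identityMatrix n i j - var * permutationMatrix σ i j

  -- The weighted matrix places the entry of row `i` in column `σ i`, while `permutationMatrix`
  -- places the entry of column `j` in row `σ j`; hence the inverse. It disappears again when
  -- summing over all permutations.
  permutationDet≈weightedDet : ∀ {n} (σ : Permutation′ n) → permutationDet σ ≈ weightedDet (λ _ → 0) (Perm.flip σ)
  permutationDet≈weightedDet {n} σ = trans (det≈lap A)
    (lap-cong {A = A} {weightedMatrix (λ _ → 0) (Perm.flip σ)} λ i l →
      +-congˡ {δ i l} { - (var * permutationMatrix σ i l)} { - (var ^ 1 * δ (σ ⟨$⟩ˡ i) l)}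
        (-‿cong {var * permutationMatrix σ i l} {var ^ 1 * δ (σ ⟨$⟩ˡ i) l}
          (*-cong {var} {var ^ 1} {permutationMatrix σ i l} {δ (σ ⟨$⟩ˡ i) l} (sym (*-identityʳ var))
            (reflexive (≡.cong (λ b → if b then 1# else 0#) (does-⇔ (mk⇔
              (λ i≡σl → ≡.trans (≡.cong (σ ⟨$⟩ˡ_) i≡σl) (Perm.inverseˡ σ))
              (λ σ⁻¹i≡l → ≡.trans (≡.sym (Perm.inverseʳ σ)) (≡.cong (σ ⟨$⟩ʳ_) σ⁻¹i≡l)))
              (i ≟ σ ⟨$⟩ʳ l) (σ ⟨$⟩ˡ i ≟ l)))))))
    where
    A : Matrix n
    A i j = identityMatrix n i j - var * permutationMatrix σ i j

  ∑Perm-permutationDet : ∀ n → ∑Perm (suc n) (λ σ → permutationDet σ ^ℤ r) ≈ hookSum 0 n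
  ∑Perm-permutationDet n = begin
    ∑Perm (suc n) (λ σ → permutationDet σ ^ℤ r)
      ≈⟨ ∑ˡ-cong (λ σ → sym (^ℤ-cong r (weightedDet-constantTerm (λ _ → 0) (Perm.flip σ))
           (sym (permutationDet≈weightedDet σ)))) (perms (suc n)) ⟩
    ∑Perm (suc n) (weightedDetPower (λ _ → 0) ∘ Perm.flip)
      ≈⟨ ∑Perm-bijection {f = weightedDetPower (λ _ → 0)} (λ {σ} {τ} → weightedDetPower-cong (λ _ → 0) {σ} {τ})
           Perm.flip Perm.flip (λ {σ} {τ} → flip-adjoint σ τ) (λ {σ} {τ} σ≈ → flip-adjoint τ σ σ≈) ⟩
    ∑Perm (suc n) (weightedDetPower (λ _ → 0))
      ≈⟨ ∑Perm-weightedDetPower {suc n} (λ _ → 0) ⟩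
    cycleSum {suc n} (λ _ → 0)
      ≈⟨ cycleSum-cong {suc n} (λ _ → 0) (0 ∷ᵛ λ _ → 0) (∷-cong ≡.refl λ _ → ≡.refl) ⟩
    cycleSum (0 ∷ᵛ λ (_ : Fin n) → 0)
      ≈⟨ cycleSum-hook 0 n ⟩
    hookSum 0 n ∎
    where
    flip-adjoint : ∀ (σ τ : Permutation′ (suc n)) → τ Perm.≈ Perm.flip σ → σ Perm.≈ Perm.flip τ
    flip-adjoint σ τ τ≈σ⁻¹ i = ≡.trans (≡.sym (Perm.inverseˡ τ))
      (≡.cong (τ ⟨$⟩ˡ_) (≡.trans (τ≈σ⁻¹ (σ ⟨$⟩ʳ i)) (Perm.inverseˡ σ)))

-- Logarithmic derivatives and the recurrence for coefficients.

module LogarithmicDerivative {c ℓ} (S : CommutativeRing c ℓ) where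

  open CommutativeRing S hiding (zero)
  open SemiringMult semiring using (_×_)
  open RawSemiringDefs (Semiring.rawSemiring semiring) using (_^_; product; sum)
  open RingProperties ring using (x+x≈x⇒x≈0)
  open AbelianGroupProperties +-abelianGroup using (inverseʳ-unique)
  open SemiringSolver commutativeSemiring using (solve; _:=_; _:+_; _:*_)
  open SetoidReasoning setoid

  module Derivation
    (θ : Carrier → Carrier) (θ-cong : ∀ {f g} → f ≈ g → θ f ≈ θ g)
    (θ-* : ∀ f g → θ (f * g) ≈ θ f * g + f * θ g) where

    infix 4 _▷_
    -- `g` is the logarithmic derivative of `f`, expressed without dividing by `f`.
    _▷_ : Carrier → Carrier → Set ℓ
    f ▷ g = θ f ≈ f * g

    ▷-* : ∀ {f g f′ g′} → f ▷ g → f′ ▷ g′ → f * f′ ▷ g + g′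
    ▷-* {f} {g} {f′} {g′} f▷g f′▷g′ = begin
      θ (f * f′)                   ≈⟨ θ-* f f′ ⟩
      θ f * f′ + f * θ f′          ≈⟨ +-cong (*-congʳ f▷g) (*-congˡ f′▷g′) ⟩
      f * g * f′ + f * (f′ * g′)   ≈⟨ solve 4 (λ f g h k → f :* g :* h :+ f :* (h :* k) := f :* h :* (g :+ k)) refl f g f′ g′ ⟩
      f * f′ * (g + g′)            ∎

    θ-1 : θ 1# ≈ 0#
    θ-1 = x+x≈x⇒x≈0 (θ 1#) (begin
      θ 1# + θ 1#            ≈⟨ +-cong (*-identityʳ (θ 1#)) (*-identityˡ (θ 1#)) ⟨
      θ 1# * 1# + 1# * θ 1#  ≈⟨ θ-* 1# 1# ⟨
      θ (1# * 1#)            ≈⟨ θ-cong (*-identityʳ 1#) ⟩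
      θ 1#                   ∎)

    ▷-1 : 1# ▷ 0#
    ▷-1 = trans θ-1 (sym (zeroʳ 1#))

    -- Differentiating `f * h ≈ 1#` gives `f * θ h ≈ - (f * g * h)`; multiplying by `h` isolates
    -- `θ h`.
    ▷-inverse : ∀ {f g h} → f * h ≈ 1# → f ▷ g → h ▷ - g
    ▷-inverse {f} {g} {h} fh≈1 f▷g = begin
      θ h                ≈⟨ *-identityˡ (θ h) ⟨
      1# * θ h           ≈⟨ *-congʳ fh≈1 ⟨
      f * h * θ h        ≈⟨ solve 3 (λ f h t → f :* h :* t := h :* (f :* t)) refl f h (θ h) ⟩
      h * (f * θ h)      ≈⟨ *-congˡ (inverseʳ-unique (f * g * h) (f * θ h) (begin
                              f * g * h + f * θ h  ≈⟨ +-congʳ (*-congʳ f▷g) ⟨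
                              θ f * h + f * θ h    ≈⟨ θ-* f h ⟨
                              θ (f * h)            ≈⟨ θ-cong fh≈1 ⟩
                              θ 1#                 ≈⟨ θ-1 ⟩
                              0#                   ∎)) ⟩
      h * - (f * g * h)  ≈⟨ *-congˡ (-‿cong (begin
                              f * g * h    ≈⟨ solve 3 (λ f g h → f :* g :* h := f :* h :* g) refl f g h ⟩
                              f * h * g    ≈⟨ *-congʳ fh≈1 ⟩
                              1# * g       ≈⟨ *-identityˡ g ⟩
                              g            ∎)) ⟩
      h * - g            ∎

    ▷-^ : ∀ n {f g} → f ▷ g → f ^ n ▷ n × g
    ▷-^ zero    f▷g = ▷-1
    ▷-^ (suc n) f▷g = ▷-* f▷g (▷-^ n f▷g)

    ▷-product : ∀ N {f g : Fin N → Carrier} → (∀ k → f k ▷ g k) → product f ▷ sum g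
    ▷-product zero    f▷g = ▷-1
    ▷-product (suc N) f▷g = ▷-* (f▷g zero) (▷-product N (f▷g ∘ suc))

module SeriesLogarithmicDerivative {c ℓ} (R : CommutativeRing c ℓ) where

  open PowerSeries R
  module S = CommutativeRing commutativeRing
  open CommutativeRing R hiding (zero)
  open SemiringSum semiring
  open SemiringMult semiring using (_×_; ×-homo-+; ×-congʳ; ×-assoc-*; ×-comm-*; ×-assocˡ)
  open SemiringMult S.semiring using () renaming (_×_ to _×ˢ_)
  open MonoidMult +-commutativeMonoid using (×-distrib-+)
  open RawSemiringDefs (Semiring.rawSemiring semiring) using (_^_)
  open RingProperties ring using (-0#≈0#; -‿distribʳ-*; -‿involutive)
  open SetoidReasoning setoid

  θ : Series → Series
  θ f n = n × f n

  ×-zero : ∀ m {x} → x ≈ 0# → m × x ≈ 0#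
  ×-zero zero    x≈0 = refl
  ×-zero (suc m) x≈0 = trans (+-cong x≈0 (×-zero m x≈0)) (+-identityˡ 0#)

  ×-sum : ∀ m {n} (f : Fin n → Carrier) → m × ∑[ i < n ] f i ≈ ∑[ i < n ] (m × f i)
  ×-sum m {zero}  f = ×-zero m refl
  ×-sum m {suc n} f = trans (×-distrib-+ (f zero) _ m) (+-congˡ (×-sum m (f ∘ suc)))

  -- `θ` is the Euler operator, the variable times the derivative. The Leibniz rule holds termwise
  -- because the degree splits as `n = i + (n - i)`.
  θ-* : ∀ f g → θ (f ⊛ g) ≋ θ f ⊛ g ⊕ f ⊛ θ g
  θ-* f g n = begin
    n × ∑[ i ≤ n ] (f (toℕ i) * g (n ∸ toℕ i))
      ≈⟨ ×-sum n (λ (i : Fin (suc n)) → f (toℕ i) * g (n ∸ toℕ i)) ⟩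
    ∑[ i ≤ n ] (n × (f (toℕ i) * g (n ∸ toℕ i)))
      ≈⟨ sum-cong-≋ {suc n} (λ i → leibniz (toℕ i) (toℕ≤pred[n] i)) ⟩
    ∑[ i ≤ n ] (θ f (toℕ i) * g (n ∸ toℕ i) + f (toℕ i) * θ g (n ∸ toℕ i))
      ≈⟨ ∑-distrib-+ {suc n} (λ i → θ f (toℕ i) * g (n ∸ toℕ i)) (λ i → f (toℕ i) * θ g (n ∸ toℕ i)) ⟩
    (θ f ⊛ g ⊕ f ⊛ θ g) n ∎
    where
    leibniz : ∀ i → i ℕ.≤ n → n × (f i * g (n ∸ i)) ≈ θ f i * g (n ∸ i) + f i * θ g (n ∸ i)
    leibniz i i≤n = begin
      n × (f i * g (n ∸ i))
        ≡⟨ ≡.cong (_× (f i * g (n ∸ i))) (ℕ.m+[n∸m]≡n i≤n) ⟨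
      (i ℕ.+ (n ∸ i)) × (f i * g (n ∸ i))
        ≈⟨ ×-homo-+ (f i * g (n ∸ i)) i (n ∸ i) ⟩
      i × (f i * g (n ∸ i)) + (n ∸ i) × (f i * g (n ∸ i))
        ≈⟨ +-cong (×-assoc-* i (f i) (g (n ∸ i))) (×-comm-* (n ∸ i) (f i) (g (n ∸ i))) ⟨
      θ f i * g (n ∸ i) + f i * θ g (n ∸ i) ∎

  open LogarithmicDerivative.Derivation commutativeRing θ (λ f≋g n → ×-congʳ n (f≋g n)) θ-* public

  -- The case split copies that of `_^ℤ_`: a negative power is a natural power of `inv f`, whose
  -- logarithmic derivative is `S.- g`.
  _·_ : ℤ → Series → Series
  (+ n)    · g = n ×ˢ g
  -[1+ n ] · g = suc n ×ˢ (S.- g)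

  ▷-^ℤ : ∀ r {f g} → f 0 ≈ 1# → f ▷ g → f ^ℤ r ▷ r · g
  ▷-^ℤ (+ n)    {f} {g} f₀ f▷g = ▷-^ n {f} {g} f▷g
  ▷-^ℤ -[1+ n ] {f} {g} f₀ f▷g =
    ▷-^ (suc n) {inv f} {S.- g} (▷-inverse {f} {g} {inv f} (inv-inverseʳ f f₀) f▷g)

  ×ˢ-coefficient : ∀ k g n → (k ×ˢ g) n ≡ k × g n
  ×ˢ-coefficient zero    g n = ≡.refl
  ×ˢ-coefficient (suc k) g n = ≡.cong (_+_ (g n)) (×ˢ-coefficient k g n)

  ∑-coefficient : ∀ N (g : Fin N → Series) n → SemiringSum.sum S.semiring g n ≡ ∑[ k < N ] g k n
  ∑-coefficient zero    g n = ≡.refl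
  ∑-coefficient (suc N) g n = ≡.cong (_+_ (g zero n)) (∑-coefficient N (g ∘ suc) n)

  -- Used on two levels: over ℤ⟦x⟧ with `a` a power of x it is the base of `factor`, over ℤ with
  -- `a = 1` it is 1 - x.
  oneMinus : Carrier → Series
  oneMinus a = S.1# S.- var ⊛ const a

  var-⊛-suc : ∀ f n → (var ⊛ f) (suc n) ≈ f n
  var-⊛-suc f n = begin
    0# * f (suc n) + ((var ∘ suc) ⊛ f) n
      ≈⟨ +-cong (zeroˡ _) (⊛-cong {var ∘ suc} {const 1#} {f} var∘suc (λ _ → refl) n) ⟩
    0# + (const 1# ⊛ f) n
      ≈⟨ trans (+-identityˡ _) (⊛-identityˡ f n) ⟩
    f n ∎
    where
    var∘suc : var ∘ suc ≋ const 1#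
    var∘suc zero    = refl
    var∘suc (suc _) = refl

  x-0≈x : ∀ {x y} → y ≈ 0# → x - y ≈ x
  x-0≈x y≈0 = trans (+-congˡ (trans (-‿cong y≈0) -0#≈0#)) (+-identityʳ _)

  var-⊛-zero : ∀ f → (var ⊛ f) 0 ≈ 0#
  var-⊛-zero f = trans (+-identityʳ _) (zeroˡ _)

  oneMinus-⊛-zero : ∀ a f → (oneMinus a ⊛ f) 0 ≈ f 0
  oneMinus-⊛-zero a f = begin
    (1# - (var ⊛ const a) 0) * f 0 + 0#  ≈⟨ +-identityʳ _ ⟩
    (1# - (var ⊛ const a) 0) * f 0       ≈⟨ *-congʳ (x-0≈x (var-⊛-zero (const a))) ⟩
    1# * f 0                             ≈⟨ *-identityˡ _ ⟩
    f 0                                  ∎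

  oneMinus-⊛-suc : ∀ a f n → (oneMinus a ⊛ f) (suc n) ≈ f (suc n) - a * f n
  oneMinus-⊛-suc a f n = begin
    (oneMinus a ⊛ f) (suc n)
      ≈⟨ S.distribʳ f (const 1#) (S.- (var ⊛ const a)) (suc n) ⟩
    (const 1# ⊛ f) (suc n) + ((S.- (var ⊛ const a)) ⊛ f) (suc n)
      ≈⟨ +-cong (⊛-identityˡ f (suc n)) (S.sym (RingProperties.-‿distribˡ-* S.ring (var ⊛ const a) f) (suc n)) ⟩
    f (suc n) - ((var ⊛ const a) ⊛ f) (suc n)
      ≈⟨ +-congˡ (-‿cong (trans (⊛-assoc var (const a) f (suc n))
           (trans (var-⊛-suc (const a ⊛ f) n) (const-⊛ a f n)))) ⟩
    f (suc n) - a * f n ∎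

  oneMinus-constantTerm : ∀ a → oneMinus a 0 ≈ 1#
  oneMinus-constantTerm a = trans (sym (S.*-identityʳ (oneMinus a) 0)) (oneMinus-⊛-zero a S.1#)

  -- With y the variable, this is the series a y / (1 - a y), the negative of the logarithmic
  -- derivative of 1 - a y.
  geometric : Carrier → Series
  geometric a zero    = 0#
  geometric a (suc n) = a ^ suc n

  oneMinus-▷ : ∀ a → oneMinus a ▷ S.- geometric a
  oneMinus-▷ a zero = sym (trans (oneMinus-⊛-zero a (S.- geometric a)) -0#≈0#)
  oneMinus-▷ a (suc n) = begin
    suc n × oneMinus a (suc n)
      ≈⟨ ×-congʳ (suc n) (trans (sym (S.*-identityʳ (oneMinus a) (suc n)))
           (trans (oneMinus-⊛-suc a S.1# n) (+-identityˡ _))) ⟩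
    suc n × (- (a * const 1# n))
      ≈⟨ lemma n ⟩
    - (a ^ suc n) - a * - geometric a n
      ≈⟨ oneMinus-⊛-suc a (S.- geometric a) n ⟨
    (oneMinus a ⊛ (S.- geometric a)) (suc n) ∎
    where
    -‿cancel : ∀ x y → - (x * y) - x * - y ≈ 0#
    -‿cancel x y = trans (+-congˡ (trans (-‿cong (sym (-‿distribʳ-* x y))) (-‿involutive _))) (-‿inverseˡ _)

    lemma : ∀ n → suc n × (- (a * const 1# n)) ≈ - (a ^ suc n) - a * - geometric a n
    lemma zero    = trans (+-identityʳ _) (sym (x-0≈x (trans (*-congˡ -0#≈0#) (zeroʳ a))))
    lemma (suc n) = trans (×-zero (suc (suc n)) (trans (-‿cong (zeroʳ a)) -0#≈0#)) (sym (-‿cancel a (a ^ suc n)))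

  -- The coefficientwise form of θ P = P G for G with constant term 0,
  -- in terms of the coefficients q a of G in degree a + 1.
  module _ (q : ℕ → Carrier) (P : Series) (P₀ : P 0 ≈ 1#)
           (recurrence : ∀ n → suc n × P (suc n) ≈ (q ⊛ P) n) where

    open CycleSums R q using (hookSum)

    -- Splitting off the term of index 0 turns the convolution for `a` into the one for `suc a`. The
    -- split term is recognised through `hookSum-P`, which comes from the case `a = 0` one step
    -- earlier; hence the mutual induction.
    hookSum-convolution : ∀ a n → hookSum a n ≈ (n !) × (((λ i → q (a ℕ.+ i)) ⊛ P) n)
    hookSum-P : ∀ n → hookSum 0 n ≈ (suc n !) × P (suc n)

    hookSum-convolution a zero = sym (begin
      q (a ℕ.+ 0) * P 0 + 0# + 0#  ≈⟨ trans (+-identityʳ _) (+-identityʳ _) ⟩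
      q (a ℕ.+ 0) * P 0            ≈⟨ *-cong (reflexive (≡.cong q (ℕ.+-identityʳ a))) P₀ ⟩
      q a * 1#                     ≈⟨ *-identityʳ _ ⟩
      q a                          ∎)
    hookSum-convolution a (suc n) = begin
      q a * hookSum 0 n + suc n × hookSum (suc a) n
        ≈⟨ +-cong (trans (*-congˡ (hookSum-P n)) (×-comm-* (suc n !) (q a) (P (suc n))))
             (trans (×-congʳ (suc n) (hookSum-convolution (suc a) n)) (×-assocˡ _ (suc n) (n !))) ⟩
      (suc n !) × (q a * P (suc n)) + (suc n !) × (((λ i → q (suc a ℕ.+ i)) ⊛ P) n)
        ≈⟨ ×-distrib-+ _ _ (suc n !) ⟨
      (suc n !) × (q a * P (suc n) + ((λ i → q (suc a ℕ.+ i)) ⊛ P) n)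
        ≈⟨ ×-congʳ (suc n !) (+-cong (*-congʳ (reflexive (≡.cong q (≡.sym (ℕ.+-identityʳ a)))))
             (⊛-cong {λ i → q (suc a ℕ.+ i)} {λ i → q (a ℕ.+ suc i)} {P}
               (λ i → reflexive (≡.cong q (≡.sym (ℕ.+-suc a i)))) (λ _ → refl) n)) ⟩
      (suc n !) × (((λ i → q (a ℕ.+ i)) ⊛ P) (suc n)) ∎

    hookSum-P n = begin
      hookSum 0 n                ≈⟨ hookSum-convolution 0 n ⟩
      (n !) × ((q ⊛ P) n)          ≈⟨ ×-congʳ (n !) (recurrence n) ⟨
      (n !) × (suc n × P (suc n))  ≈⟨ ×-assocˡ (P (suc n)) (n !) (suc n) ⟩
      (n ! ℕ.* suc n) × P (suc n) ≡⟨ ≡.cong (_× P (suc n)) (ℕ.*-comm (n !) (suc n)) ⟩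
      (suc n !) × P (suc n)        ∎

  ▷-recurrence : ∀ {P G} → G 0 ≈ 0# → P ▷ G → ∀ n → suc n × P (suc n) ≈ ((G ∘ suc) ⊛ P) n
  ▷-recurrence {P} {G} G₀ P▷G n = begin
    suc n × P (suc n)                    ≈⟨ P▷G (suc n) ⟩
    (P ⊛ G) (suc n)                      ≈⟨ ⊛-comm P G (suc n) ⟩
    G 0 * P (suc n) + ((G ∘ suc) ⊛ P) n  ≈⟨ +-congʳ (trans (*-congʳ G₀) (zeroˡ _)) ⟩
    0# + ((G ∘ suc) ⊛ P) n               ≈⟨ +-identityˡ _ ⟩
    ((G ∘ suc) ⊛ P) n                    ∎

-- Congruence modulo a power of the variable, and truncated substitution.

module Truncation {c ℓ} (R : CommutativeRing c ℓ) where

  open PowerSeries R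
  module R = CommutativeRing R
  module RP = RingProperties R.ring
  module RS = SemiringSum R.semiring
  open CommutativeRing commutativeRing hiding (zero)
  open SemiringMult semiring using (_×_)
  open SemiringSum semiring using (sum-syntax)
  open RawSemiringDefs (Semiring.rawSemiring semiring) using (_^_)
  open SeriesPowers R using (inv-cancelˡ; inv-cancelʳ)
  open SeriesLogarithmicDerivative R using (oneMinus; oneMinus-⊛-zero; oneMinus-⊛-suc; oneMinus-constantTerm)
  open SemiringSolver commutativeSemiring using (solve; _:=_; _:+_; _:*_)

  infix 4 _≈[_]_
  _≈[_]_ : Series → ℕ → Series → Set ℓ
  f ≈[ N ] g = ∀ {m} → m ℕ.< N → f m R.≈ g m

  module _ {N : ℕ} where

    mod-reflexive : ∀ {f g} → f ≈ g → f ≈[ N ] g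
    mod-reflexive f≈g {m} _ = f≈g m

    mod-trans : ∀ {f g h} → f ≈[ N ] g → g ≈[ N ] h → f ≈[ N ] h
    mod-trans f≈g g≈h m<N = R.trans (f≈g m<N) (g≈h m<N)

    mod-setoid : Setoid c ℓ
    mod-setoid = record
      { Carrier       = Series
      ; _≈_           = λ f g → f ≈[ N ] g
      ; isEquivalence = record
        { refl  = λ _ → R.refl
        ; sym   = λ f≈g m<N → R.sym (f≈g m<N)
        ; trans = λ {f} {g} {h} → mod-trans {f} {g} {h}
        }
      }

    mod-+-cong : ∀ {f f′ g g′} → f ≈[ N ] f′ → g ≈[ N ] g′ → f + g ≈[ N ] f′ + g′
    mod-+-cong f≈f′ g≈g′ m<N = R.+-cong (f≈f′ m<N) (g≈g′ m<N)

    mod-*-cong : ∀ {f f′ g g′} → f ≈[ N ] f′ → g ≈[ N ] g′ → f * g ≈[ N ] f′ * g′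
    mod-*-cong f≈f′ g≈g′ {m} m<N = RS.sum-cong-≋ {suc m} λ i →
      R.*-cong (f≈f′ (ℕ.≤-<-trans (toℕ≤pred[n] i) m<N)) (g≈g′ (ℕ.≤-<-trans (ℕ.m∸n≤m m (toℕ i)) m<N))

    mod-×-cong : ∀ k {f g} → f ≈[ N ] g → k × f ≈[ N ] k × g
    mod-×-cong zero            f≈g _   = R.refl
    mod-×-cong (suc k) {f} {g} f≈g m<N = R.+-cong (f≈g m<N) (mod-×-cong k {f} {g} f≈g m<N)

  hookSum-mod : ∀ {N q q′} → (∀ a → q a ≈[ N ] q′ a) → ∀ a n →
    CycleSums.hookSum commutativeRing q a n ≈[ N ] CycleSums.hookSum commutativeRing q′ a n
  hookSum-mod q≈q′ a zero    = q≈q′ a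
  hookSum-mod {N} {q} {q′} q≈q′ a (suc n) = mod-+-cong
    {f = q a * hook q 0 n} {q′ a * hook q′ 0 n} {suc n × hook q (suc a) n} {suc n × hook q′ (suc a) n}
    (mod-*-cong {f = q a} {q′ a} {hook q 0 n} {hook q′ 0 n} (q≈q′ a) (hookSum-mod {N} {q} {q′} q≈q′ 0 n))
    (mod-×-cong (suc n) {hook q (suc a) n} {hook q′ (suc a) n} (hookSum-mod {N} {q} {q′} q≈q′ (suc a) n))
    where hook = CycleSums.hookSum commutativeRing

  ^-order : ∀ k {z} → z 0 R.≈ R.0# → z ^ k ≈[ k ] 0#
  ^-order (suc k) {z} z₀ {zero}  _ = R.trans (R.+-identityʳ _) (R.trans (R.*-congʳ z₀) (R.zeroˡ _))
  ^-order (suc k) {z} z₀ {suc m} (ℕ.s≤s m<k) = R.trans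
    (R.+-cong (R.trans (R.*-congʳ z₀) (R.zeroˡ _))
      (RS.sum-cong-≋ {suc m} λ i → R.trans
        (R.*-congˡ (^-order k {z} z₀ (ℕ.≤-<-trans (ℕ.m∸n≤m m (toℕ i)) m<k))) (R.zeroʳ (z (suc (toℕ i))))))
    (R.trans (R.+-identityˡ _) (RS.sum-replicate-zero (suc m)))

  -- Horner's scheme for the polynomial with the first `N` coefficients of `f`. Truncation keeps
  -- substitution a finite sum, so no composition of series has to be defined.
  evaluate : ℕ → Series → (ℕ → Series) → Series
  evaluate zero    z f = 0#
  evaluate (suc N) z f = f 0 + z * evaluate N z (f ∘ suc)

  module Evaluation (z : Series) where
    open SetoidReasoning setoid

    evaluate-cong : ∀ N {f g : ℕ → Series} → (∀ k → f k ≈ g k) → evaluate N z f ≈ evaluate N z g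
    evaluate-cong zero            f≈g = refl
    evaluate-cong (suc N) {f} {g} f≈g = +-cong
      {f 0} {g 0} {z * evaluate N z (f ∘ suc)} {z * evaluate N z (g ∘ suc)} (f≈g 0)
      (*-congˡ {z} {evaluate N z (f ∘ suc)} {evaluate N z (g ∘ suc)} (evaluate-cong N {f ∘ suc} {g ∘ suc} (f≈g ∘ suc)))

    evaluate-0 : ∀ N → evaluate N z (λ _ → 0#) ≈ 0#
    evaluate-0 zero    = refl
    evaluate-0 (suc N) = trans (+-identityˡ (z * evaluate N z (λ _ → 0#)))
      (trans (*-congˡ {z} {evaluate N z (λ _ → 0#)} {0#} (evaluate-0 N)) (zeroʳ z))

    -- If g k = f k - f (k - 1), then the polynomial of g is the product of
    -- 1 - z and the polynomial of f, up to a multiple of z ^ N; b stands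
    -- for f (- 1), and subtraction is avoided.
    evaluate-difference : ∀ N b (f g : ℕ → Series) → g 0 + b ≈ f 0 → (∀ k → g (suc k) + f k ≈ f (suc k)) →
      ∃[ e ] evaluate N z g + b + z * evaluate N z f ≈ evaluate N z f + z ^ N * e
    evaluate-difference zero    b f g g₀ gₛ = b , (begin
      0# + b + z * 0#  ≈⟨ +-congˡ {0# + b} {z * 0#} {0#} (zeroʳ z) ⟩
      0# + b + 0#      ≈⟨ +-identityʳ (0# + b) ⟩
      0# + b           ≈⟨ +-congˡ {0#} {1# * b} {b} (*-identityˡ b) ⟨
      0# + 1# * b      ∎)
    evaluate-difference (suc N) b f g g₀ gₛ =
      -- After dropping the first coefficients, `f 0` plays the part of `b`. Unwinding this, the
      -- witness `e` is the coefficient of `f` with index one below the truncation.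
      let e , eq = evaluate-difference N (f 0) (f ∘ suc) (g ∘ suc) (gₛ 0) (gₛ ∘ suc)
          F = evaluate N z (f ∘ suc)
          G = evaluate N z (g ∘ suc)
      in e , (begin
      g 0 + z * G + b + z * (f 0 + z * F)
        ≈⟨ solve 6 (λ g₀ z G b f₀ F → g₀ :+ z :* G :+ b :+ z :* (f₀ :+ z :* F) :=
                                      g₀ :+ b :+ z :* (G :+ f₀ :+ z :* F)) refl (g 0) z G b (f 0) F ⟩
      g 0 + b + z * (G + f 0 + z * F)
        ≈⟨ +-cong {g 0 + b} {f 0} {z * (G + f 0 + z * F)} {z * (F + z ^ N * e)} g₀
             (*-congˡ {z} {G + f 0 + z * F} {F + z ^ N * e} eq) ⟩
      f 0 + z * (F + z ^ N * e)
        ≈⟨ solve 5 (λ f₀ z F w e → f₀ :+ z :* (F :+ w :* e) := f₀ :+ z :* F :+ z :* w :* e) refl (f 0) z F (z ^ N) e ⟩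
      f 0 + z * F + z ^ suc N * e ∎)

    evaluate-∑ : ∀ N (f : ℕ → Series) → evaluate N z f ≈ ∑[ k < N ] (f (toℕ k) * z ^ toℕ k)
    evaluate-∑ zero    f = refl
    evaluate-∑ (suc N) f = +-cong
      {f 0} {f 0 * 1#} {z * evaluate N z (f ∘ suc)} {∑[ k < N ] (f (suc (toℕ k)) * (z * z ^ toℕ k))}
      (sym (*-identityʳ (f 0))) (begin
        z * evaluate N z (f ∘ suc)
          ≈⟨ *-congˡ {z} {evaluate N z (f ∘ suc)} {∑[ k < N ] (f (suc (toℕ k)) * z ^ toℕ k)}
               (evaluate-∑ N (f ∘ suc)) ⟩
        z * ∑[ k < N ] (f (suc (toℕ k)) * z ^ toℕ k)
          ≈⟨ SemiringSum.*-distribˡ-sum semiring {N} z (λ k → f (suc (toℕ k)) * z ^ toℕ k) ⟩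
        ∑[ k < N ] (z * (f (suc (toℕ k)) * z ^ toℕ k))
          ≈⟨ SemiringSum.sum-cong-≋ semiring {N} (λ k →
               solve 3 (λ z f w → z :* (f :* w) := f :* (z :* w)) refl z (f (suc (toℕ k))) (z ^ toℕ k)) ⟩
        ∑[ k < N ] (f (suc (toℕ k)) * (z * z ^ toℕ k)) ∎)

  module BinomialEvaluation (N : ℕ) (z : Series) (z₀ : z 0 R.≈ R.0#) where
    open Evaluation z

    substitute : Series → Series
    substitute f = evaluate N z (const ∘ f)

    private
      u = oneMinus R.1#
      v = 1# - z

    v-constantTerm : v 0 R.≈ R.1#
    v-constantTerm = R.trans (R.+-congˡ (R.trans (R.-‿cong z₀) RP.-0#≈0#)) (R.+-identityʳ R.1#)

    const-+ : ∀ a b → const a + const b ≈ const (a R.+ b)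
    const-+ a b zero    = R.refl
    const-+ a b (suc n) = R.+-identityˡ R.0#

    const-cong : ∀ {a b} → a R.≈ b → const a ≈ const b
    const-cong a≈b zero    = a≈b
    const-cong a≈b (suc n) = R.refl

    substitute-cong : ∀ {f g} → f ≈ g → substitute f ≈ substitute g
    substitute-cong f≈g = evaluate-cong N (λ k → const-cong (f≈g k))

    const-difference : ∀ f k → const ((u * f) (suc k)) + const (f k) ≈ const (f (suc k))
    const-difference f k = trans (const-+ _ _) (const-cong (R.trans
      (R.+-congʳ (R.trans (oneMinus-⊛-suc R.1# f k) (R.+-congˡ (R.-‿cong (R.*-identityˡ (f k))))))
      (R.trans (R.+-assoc _ _ _) (R.trans (R.+-congˡ (R.-‿inverseˡ (f k))) (R.+-identityʳ _)))))

    -- The coefficients of `u * f` are the successive differences of those of `f`, starting from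
    -- `b = 0#`. The error term is a multiple of `z ^ N`, which vanishes to order `N` because `z`
    -- has constant term 0.
    substitute-oneMinus : ∀ f → substitute (u * f) ≈[ N ] v * substitute f
    substitute-oneMinus f =
      let e , eq = evaluate-difference N 0# (const ∘ f) (const ∘ (u * f))
            (trans (+-identityʳ (const ((u * f) 0))) (const-cong (oneMinus-⊛-zero R.1# f)))
            (const-difference f)
      in begin
      G
        ≈⟨ mod-reflexive {f = G} {G + 0# + z * F - z * F} (sym (trans
             (+-assoc (G + 0#) (z * F) (- (z * F)))
             (trans (+-cong {G + 0#} {G} {z * F - z * F} {0#} (+-identityʳ G) (-‿inverseʳ (z * F)))
                    (+-identityʳ G)))) ⟩
      G + 0# + z * F - z * F
        ≈⟨ mod-reflexive {f = G + 0# + z * F - z * F} {F + z ^ N * e - z * F}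
             (+-congʳ { - (z * F)} {G + 0# + z * F} {F + z ^ N * e} eq) ⟩
      F + z ^ N * e - z * F
        ≈⟨ mod-+-cong {f = F + z ^ N * e} {F + 0#} { - (z * F)} { - (z * F)}
             (mod-+-cong {f = F} {F} {z ^ N * e} {0#} (λ _ → R.refl)
               (mod-trans {f = z ^ N * e} {0# * e} {0#}
                 (mod-*-cong {f = z ^ N} {0#} {e} {e} (^-order N {z} z₀) (λ _ → R.refl))
                 (mod-reflexive (zeroˡ e))))
             (λ _ → R.refl) ⟩
      F + 0# - z * F
        ≈⟨ mod-reflexive {f = F + 0# - z * F} {v * F} (sym (trans ([y-z]x≈yx-zx F 1# z)
             (+-congʳ { - (z * F)} {1# * F} {F + 0#} (trans (*-identityˡ F) (sym (+-identityʳ F)))))) ⟩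
      v * F ∎
      where
      open SetoidReasoning (mod-setoid {N})
      open RingProperties ring using ([y-z]x≈yx-zx)
      F = substitute f
      G = substitute (u * f)

    substitute-1 : substitute 1# ≈[ N ] 1#
    substitute-1 = 1-mod N
      where
      const-0 : const R.0# ≈ 0#
      const-0 zero    = R.refl
      const-0 (suc _) = R.refl

      tail≈0 : ∀ M → evaluate M z (λ _ → const R.0#) ≈ 0#
      tail≈0 M = trans (evaluate-cong M {λ _ → const R.0#} {λ _ → 0#} λ _ → const-0) (evaluate-0 M)

      1-mod : ∀ M → evaluate M z (const ∘ 1#) ≈[ M ] 1#
      1-mod (suc M) {m} _ = trans
        (+-congˡ {1#} {z * evaluate M z (λ _ → const R.0#)} {0#}
          (trans (*-congˡ {z} {evaluate M z (λ _ → const R.0#)} {0#} (tail≈0 M)) (zeroʳ z)))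
        (+-identityʳ 1#) m

    -- Multiplicativity is needed only for the factor `u`. For a negative exponent, `v` times the
    -- substituted power is the substitution of `u * inv u ^ suc n`, where `u` cancels; `inv v` then
    -- removes `v`.
    substitute-^ℤ : ∀ r → substitute (u ^ℤ r) ≈[ N ] v ^ℤ r
    substitute-^ℤ (+ n)    = positive n
      where
      positive : ∀ n → substitute (u ^ n) ≈[ N ] v ^ n
      positive zero    = substitute-1
      positive (suc n) = mod-trans {f = substitute (u ^ suc n)} {v * substitute (u ^ n)} {v ^ suc n}
        (substitute-oneMinus (u ^ n)) (mod-*-cong {f = v} {v} {substitute (u ^ n)} {v ^ n} (λ _ → R.refl) (positive n))
    substitute-^ℤ -[1+ n ] = negative (suc n)
      where
      negative : ∀ n → substitute (inv u ^ n) ≈[ N ] inv v ^ n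
      negative zero    = substitute-1
      negative (suc n) = begin
        A
          ≈⟨ mod-reflexive {f = A} {inv v * (v * A)} (sym (inv-cancelˡ A v-constantTerm)) ⟩
        inv v * (v * A)
          ≈⟨ mod-*-cong {f = inv v} {inv v} {B} {v * A} (λ _ → R.refl) (substitute-oneMinus (inv u ^ suc n)) ⟨
        inv v * B
          ≈⟨ mod-reflexive {f = inv v * B} {inv v * substitute (inv u ^ n)}
               (*-congˡ {inv v} {B} {substitute (inv u ^ n)}
                 (substitute-cong (inv-cancelʳ {u} (inv u ^ n) (oneMinus-constantTerm R.1#)))) ⟩
        inv v * substitute (inv u ^ n)
          ≈⟨ mod-*-cong {f = inv v} {inv v} {substitute (inv u ^ n)} {inv v ^ n} (λ _ → R.refl) (negative n) ⟩
        inv v ^ suc n ∎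
        where
        open SetoidReasoning (mod-setoid {N})
        A = substitute (inv u ^ suc n)
        B = substitute (u * inv u ^ suc n)

-- Integer arithmetic and the coefficients of the binomial series.

ℤ-×≡* : ∀ n z → SemiringMult._×_ ℤ.+-*-semiring n z ≡ + n ℤ.* z
ℤ-×≡* zero    z = ≡.sym (ℤ.*-zeroˡ z)
ℤ-×≡* (suc n) z = ≡.trans (≡.cong (ℤ._+_ z) (ℤ-×≡* n z)) (≡.sym (ℤ.suc-* (+ n) z))

neg-*-neg : ∀ i j → ℤ.- i ℤ.* (ℤ.- j) ≡ i ℤ.* j
neg-*-neg = solve 2 (λ i j → (:- i) :* (:- j) := i :* j) ≡.refl
  where open ℤSolver.+-*-Solver

*-/ℕ-cancel : ∀ d .{{_ : ℕ.NonZero d}} i → (+ d ℤ.* i) ℤ./ℕ d ≡ i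
*-/ℕ-cancel d@(suc _) i = ℤ.≤-antisym
  (ℤ.*-cancelʳ-≤-pos _ _ (+ d) (ℤ.≤-trans (ℤ.[n/ℕd]*d≤n (+ d ℤ.* i) d) (ℤ.≤-reflexive (ℤ.*-comm (+ d) i))))
  (≡.subst (i ℤ.≤_) (ℤ.pred-suc q) (ℤ.i<j⇒i≤pred[j] (ℤ.*-cancelʳ-<-nonNeg {i} {ℤ.suc q} (+ d)
    (ℤ.≤-<-trans (ℤ.≤-reflexive (ℤ.*-comm i (+ d))) (ℤ.n<s[n/ℕd]*d (+ d ℤ.* i) d)))))
  where q = (+ d ℤ.* i) ℤ./ℕ d

module Binomial (r : ℤ) where

  open ≡.≡-Reasoning
  open SeriesLogarithmicDerivative ℤ.+-*-commutativeRing
  open SeriesPowers ℤ.+-*-commutativeRing using (^ℤ-constantTerm)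
  open RawSemiringDefs (Semiring.rawSemiring ℤ.+-*-semiring) using (_^_)

  binomialSeries : ℤx.Series
  binomialSeries = oneMinus ℤ.1ℤ ℤx.^ℤ r

  ·-coefficient : ∀ i g n → (i · g) n ≡ i ℤ.* g n
  ·-coefficient (+ k)    g n = ≡.trans (×ˢ-coefficient k g n) (ℤ-×≡* k (g n))
  ·-coefficient -[1+ k ] g n = ≡.trans (×ˢ-coefficient (suc k) (ℤ⟦x⟧.- g) n)
    (≡.trans (ℤ-×≡* (suc k) (ℤ.- g n)) (neg-*-neg -[1+ k ] (g n)))

  -- The logarithmic derivative of (1 - x)^r is - r x / (1 - x), so (n + 1) times the next
  -- coefficient is - r times the sum of the coefficients up to n. The part of that sum below n is
  -- evaluated by the same identity, and contributes the summand n.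
  recurrence : ∀ n → + suc n ℤ.* binomialSeries (suc n) ≡ (+ n ℤ.- r) ℤ.* binomialSeries n
  recurrence n = ≡.trans (convolution n) (partialSums n)
    where
    open ℤSolver.+-*-Solver

    1^ : ∀ k → ℤ.1ℤ ^ k ≡ ℤ.1ℤ
    1^ zero    = ≡.refl
    1^ (suc k) = ≡.trans (ℤ.*-identityˡ _) (1^ k)

    G : ℤx.Series
    G = r · (ℤ⟦x⟧.- geometric ℤ.1ℤ)

    convolution : ∀ n → + suc n ℤ.* binomialSeries (suc n) ≡ ((λ _ → ℤ.- r) ℤ⟦x⟧.* binomialSeries) n
    convolution n = begin
      + suc n ℤ.* binomialSeries (suc n)
        ≡⟨ ℤ-×≡* (suc n) (binomialSeries (suc n)) ⟨
      SemiringMult._×_ ℤ.+-*-semiring (suc n) (binomialSeries (suc n))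
        ≡⟨ ▷-recurrence {binomialSeries} {G} (≡.trans (·-coefficient r _ 0) (ℤ.*-zeroʳ r))
             (▷-^ℤ r (oneMinus-constantTerm ℤ.1ℤ) (oneMinus-▷ ℤ.1ℤ)) n ⟩
      ((G ∘ suc) ℤ⟦x⟧.* binomialSeries) n
        ≡⟨ ℤx.⊛-cong {G ∘ suc} {λ _ → ℤ.- r} {binomialSeries} (λ k → ≡.trans (·-coefficient r _ (suc k))
             (≡.trans (≡.cong (λ i → r ℤ.* ℤ.- i) (1^ (suc k)))
               (solve 1 (λ r → r :* con (ℤ.- + 1) := :- r) ≡.refl r))) (λ _ → ≡.refl) n ⟩
      ((λ _ → ℤ.- r) ℤ⟦x⟧.* binomialSeries) n ∎

    partialSums : ∀ n → ((λ _ → ℤ.- r) ℤ⟦x⟧.* binomialSeries) n ≡ (+ n ℤ.- r) ℤ.* binomialSeries n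
    partialSums zero    =
      solve 2 (λ r f → :- r :* f :+ con (+ 0) := (con (+ 0) :- r) :* f) ≡.refl r (binomialSeries 0)
    partialSums (suc n) = ≡.trans
      (≡.cong (ℤ._+_ (ℤ.- r ℤ.* binomialSeries (suc n))) (≡.sym (convolution n)))
      (solve 3 (λ r f k → :- r :* f :+ k :* f := (k :- r) :* f) ≡.refl r (binomialSeries (suc n)) (+ suc n))

  -- The definition splits off the last factor, but the induction on `k` raises the upper argument k
  -- - r - 1 as well and therefore splits off the first.
  fallingFactorial-suc : ∀ a k → fallingFactorial (a ℤ.+ + 1) (suc k) ≡ (a ℤ.+ + 1) ℤ.* fallingFactorial a k
  fallingFactorial-suc a zero    = solve 1
    (λ a → con (+ 1) :* (a :+ con (+ 1) :- con (+ 0)) := (a :+ con (+ 1)) :* con (+ 1)) ≡.refl a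
    where open ℤSolver.+-*-Solver
  fallingFactorial-suc a (suc k) = begin
    fallingFactorial (a ℤ.+ + 1) (suc k) ℤ.* (a ℤ.+ + 1 ℤ.- + suc k)
      ≡⟨ ≡.cong₂ ℤ._*_ (fallingFactorial-suc a k)
           (solve 2 (λ a k → a :+ con (+ 1) :- (con (+ 1) :+ k) := a :- k) ≡.refl a (+ k)) ⟩
    (a ℤ.+ + 1) ℤ.* fallingFactorial a k ℤ.* (a ℤ.- + k)
      ≡⟨ ℤ.*-assoc (a ℤ.+ + 1) _ _ ⟩
    (a ℤ.+ + 1) ℤ.* fallingFactorial a (suc k) ∎
    where open ℤSolver.+-*-Solver

  -- With k! cleared, this exhibits the dividend in `binom` as a multiple of k!, so that the integer
  -- division there is exact.
  !*binomialSeries : ∀ k → + (k !) ℤ.* binomialSeries k ≡ fallingFactorial (+ k ℤ.- r ℤ.- ℤ.1ℤ) k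
  !*binomialSeries zero    = ≡.trans (ℤ.*-identityˡ _) (^ℤ-constantTerm r (oneMinus-constantTerm ℤ.1ℤ))
  !*binomialSeries (suc k) = begin
    + (suc k !) ℤ.* binomialSeries (suc k)
      ≡⟨ ≡.cong (ℤ._* binomialSeries (suc k)) (ℤ.pos-* (suc k) (k !)) ⟩
    + suc k ℤ.* + (k !) ℤ.* binomialSeries (suc k)
      ≡⟨ solve 3 (λ s k f → s :* k :* f := k :* (s :* f)) ≡.refl (+ suc k) (+ (k !)) (binomialSeries (suc k)) ⟩
    + (k !) ℤ.* (+ suc k ℤ.* binomialSeries (suc k))
      ≡⟨ ≡.cong (ℤ._*_ (+ (k !))) (recurrence k) ⟩
    + (k !) ℤ.* ((+ k ℤ.- r) ℤ.* binomialSeries k)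
      ≡⟨ solve 4 (λ k! k r f → k! :* ((k :- r) :* f) := (k :- r :- con (+ 1) :+ con (+ 1)) :* (k! :* f)) ≡.refl
           (+ (k !)) (+ k) r (binomialSeries k) ⟩
    (a ℤ.+ + 1) ℤ.* (+ (k !) ℤ.* binomialSeries k)
      ≡⟨ ≡.cong (ℤ._*_ (a ℤ.+ + 1)) (!*binomialSeries k) ⟩
    (a ℤ.+ + 1) ℤ.* fallingFactorial a k
      ≡⟨ fallingFactorial-suc a k ⟨
    fallingFactorial (a ℤ.+ + 1) (suc k)
      ≡⟨ ≡.cong (λ b → fallingFactorial b (suc k))
           (solve 2 (λ k r → k :- r :- con (+ 1) :+ con (+ 1) := con (+ 1) :+ k :- r :- con (+ 1)) ≡.refl (+ k) r) ⟩
    fallingFactorial (+ suc k ℤ.- r ℤ.- ℤ.1ℤ) (suc k) ∎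
    where
    open ℤSolver.+-*-Solver
    a = + k ℤ.- r ℤ.- ℤ.1ℤ

  binom≡ : ∀ k → binom (+ k ℤ.- r ℤ.- ℤ.1ℤ) k ≡ binomialSeries k
  binom≡ k = ≡.trans (≡.cong (λ i → (i ℤ./ℕ (k !)) {{k ℕ.!≢0}}) (≡.sym (!*binomialSeries k)))
    (*-/ℕ-cancel (k !) {{k ℕ.!≢0}} (binomialSeries k))

-- The product of the first `N` factors.

module Product (r : ℤ) (N : ℕ) where

  open SeriesLogarithmicDerivative ℤ⟦x⟧
  open Truncation ℤ.+-*-commutativeRing using (_≈[_]_; hookSum-mod; module Evaluation; module BinomialEvaluation)
  open SeriesPowers ℤ⟦x⟧ using (product-constantTerm; ^ℤ-constantTerm)
  open Binomial r using (binomialSeries; binom≡)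
  open RawSemiringDefs (Semiring.rawSemiring ℤ⟦x,y⟧.semiring) using (product; sum)
  open CommutativeSemiringExp ℤ⟦x⟧.commutativeSemiring using (_^_; ^-assocʳ)
  module ℤxθ = SeriesLogarithmicDerivative ℤ.+-*-commutativeRing
  module ∑ᶻ = SemiringSum ℤ.+-*-semiring
  open ≡.≡-Reasoning

  partialProduct : ℤ⟦x,y⟧.Carrier
  partialProduct = product {N} (factor r ∘ toℕ)

  exponent : ℕ → ℤ
  exponent k = binom (+ k ℤ.- r ℤ.- ℤ.1ℤ) k

  summand : ℕ → ℤ⟦x,y⟧.Carrier
  summand k = (ℤ.- exponent k) · (ℤ⟦x,y⟧.- geometric (ℤx.var ^ k))

  logDerivative : ℤ⟦x,y⟧.Carrier
  logDerivative = sum {N} (summand ∘ toℕ)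

  ×-coefficient : ∀ k g n m → SemiringMult._×_ ℤ⟦x,y⟧.semiring k g n m ≡ + k ℤ.* g n m
  ×-coefficient k g n m = ≡.trans (≡.cong (λ h → h m) (×ˢ-coefficient k g n))
    (≡.trans (ℤxθ.×ˢ-coefficient k (g n) m) (ℤ-×≡* k (g n m)))

  ·-coefficient : ∀ i g n m → (i · g) n m ≡ i ℤ.* g n m
  ·-coefficient (+ k)    g n m = ×-coefficient k g n m
  ·-coefficient -[1+ k ] g n m = ≡.trans (×-coefficient (suc k) (ℤ⟦x,y⟧.- g) n m) (neg-*-neg -[1+ k ] (g n m))

  summand-coefficient : ∀ k n m → summand k n m ≡ exponent k ℤ.* geometric (ℤx.var ^ k) n m
  summand-coefficient k n m = ≡.trans (·-coefficient (ℤ.- exponent k) _ n m) (neg-*-neg (exponent k) _)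

  logDerivative-coefficient : ∀ n m →
    logDerivative n m ≡ ∑ᶻ.sum {N} (λ k → exponent (toℕ k) ℤ.* geometric (ℤx.var ^ toℕ k) n m)
  logDerivative-coefficient n m = begin
    logDerivative n m
      ≡⟨ ≡.cong (λ h → h m) (∑-coefficient N (summand ∘ toℕ) n) ⟩
    SemiringSum.sum ℤ⟦x⟧.semiring {N} (λ k → summand (toℕ k) n) m
      ≡⟨ ℤxθ.∑-coefficient N (λ k → summand (toℕ k) n) m ⟩
    ∑ᶻ.sum {N} (λ k → summand (toℕ k) n m)
      ≡⟨ ∑ᶻ.sum-cong-≋ {N} (λ k → summand-coefficient (toℕ k) n m) ⟩
    ∑ᶻ.sum {N} (λ k → exponent (toℕ k) ℤ.* geometric (ℤx.var ^ toℕ k) n m) ∎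

  partialProduct-▷ : partialProduct ▷ logDerivative
  partialProduct-▷ = ▷-product N {factor r ∘ toℕ} {summand ∘ toℕ} λ k →
    ▷-^ℤ (ℤ.- exponent (toℕ k)) (oneMinus-constantTerm (ℤx.var ^ toℕ k)) (oneMinus-▷ (ℤx.var ^ toℕ k))

  logDerivative-constantTerm : logDerivative 0 ℤ⟦x⟧.≈ ℤ⟦x⟧.0#
  logDerivative-constantTerm m = ≡.trans (logDerivative-coefficient 0 m)
    (≡.trans (∑ᶻ.sum-cong-≋ {N} λ k → ℤ.*-zeroʳ (exponent (toℕ k))) (∑ᶻ.sum-replicate-zero N))

  partialProduct-constantTerm : partialProduct 0 ℤ⟦x⟧.≈ ℤ⟦x⟧.1#
  partialProduct-constantTerm = product-constantTerm N {factor r ∘ toℕ} λ k →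
    ^ℤ-constantTerm (ℤ.- exponent (toℕ k)) (oneMinus-constantTerm (ℤx.var ^ toℕ k))

  -- Exchanging the exponents in (x^k)^(a + 1) turns the sum over the factors into the binomial
  -- series of (1 - x)^r, truncated at `N` and evaluated at `z`, which is x^(a + 1). Using `N`
  -- factors thus gives precision x^N.
  logDerivative-mod : ∀ a → logDerivative (suc a) ≈[ N ] PermutationPowerSums.cyclePower ℤ.+-*-commutativeRing r a
  logDerivative-mod a {m} m<N = begin
    logDerivative (suc a) m
      ≡⟨ logDerivative-coefficient (suc a) m ⟩
    ∑ᶻ.sum {N} (λ k → exponent (toℕ k) ℤ.* ((ℤx.var ^ toℕ k) ^ suc a) m)
      ≡⟨ ∑ᶻ.sum-cong-≋ {N} (λ k → ≡.cong₂ ℤ._*_ (binom≡ (toℕ k)) (power (toℕ k))) ⟩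
    ∑ᶻ.sum {N} (λ k → binomialSeries (toℕ k) ℤ.* (z ^ toℕ k) m)
      ≡⟨ ∑ᶻ.sum-cong-≋ {N} (λ k → ℤx.const-⊛ (binomialSeries (toℕ k)) (z ^ toℕ k) m) ⟨
    ∑ᶻ.sum {N} (λ k → (ℤx.const (binomialSeries (toℕ k)) ℤ⟦x⟧.* z ^ toℕ k) m)
      ≡⟨ ℤxθ.∑-coefficient N (λ k → ℤx.const (binomialSeries (toℕ k)) ℤ⟦x⟧.* z ^ toℕ k) m ⟨
    SemiringSum.sum ℤ⟦x⟧.semiring {N} (λ k → ℤx.const (binomialSeries (toℕ k)) ℤ⟦x⟧.* z ^ toℕ k) m
      ≡⟨ Evaluation.evaluate-∑ z N (ℤx.const ∘ binomialSeries) m ⟨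
    BinomialEvaluation.substitute N z z₀ binomialSeries m
      ≡⟨ BinomialEvaluation.substitute-^ℤ N z z₀ r m<N ⟩
    PermutationPowerSums.cyclePower ℤ.+-*-commutativeRing r a m ∎
    where
    z = ℤx.var ^ suc a
    z₀ : z 0 ≡ + 0
    z₀ = ≡.refl
    power : ∀ k → ((ℤx.var ^ k) ^ suc a) m ≡ (z ^ k) m
    power k = begin
      ((ℤx.var ^ k) ^ suc a) m    ≡⟨ ^-assocʳ ℤx.var k (suc a) m ⟩
      (ℤx.var ^ (k ℕ.* suc a)) m  ≡⟨ ≡.cong (λ e → (ℤx.var ^ e) m) (ℕ.*-comm k (suc a)) ⟩
      (ℤx.var ^ (suc a ℕ.* k)) m  ≡⟨ ^-assocʳ ℤx.var (suc a) k m ⟨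
      (z ^ k) m                   ∎

  open Matrices ℤ⟦x⟧ using (∑Perm)

  -- The recurrence is exact for the coefficients of `logDerivative`. Since `hookSum` is formed from
  -- them by sums and products, replacing them by the cycle powers is harmless modulo x^N.
  permutationPowerSum : ∀ n {m} → m ℕ.< N →
    ∑Perm (suc n) (λ σ → charDet σ ℤx.^ℤ r) m ≡ + (suc n !) ℤ.* partialProduct (suc n) m
  permutationPowerSum n {m} m<N = begin
    ∑Perm (suc n) (λ σ → charDet σ ℤx.^ℤ r) m
      ≡⟨ PermutationPowerSums.∑Perm-permutationDet ℤ.+-*-commutativeRing r n m ⟩
    hookSum (PermutationPowerSums.cyclePower ℤ.+-*-commutativeRing r) 0 n m
      ≡⟨ hookSum-mod {N} {logDerivative ∘ suc} {PermutationPowerSums.cyclePower ℤ.+-*-commutativeRing r}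
           (λ a → logDerivative-mod a) 0 n m<N ⟨
    hookSum (logDerivative ∘ suc) 0 n m
      ≡⟨ hookSum-P (logDerivative ∘ suc) partialProduct partialProduct-constantTerm
           (▷-recurrence {partialProduct} {logDerivative} logDerivative-constantTerm partialProduct-▷) n m ⟩
    SemiringMult._×_ ℤ⟦x⟧.semiring (suc n !) (partialProduct (suc n)) m
      ≡⟨ ℤxθ.×ˢ-coefficient (suc n !) (partialProduct (suc n)) m ⟩
    SemiringMult._×_ ℤ.+-*-semiring (suc n !) (partialProduct (suc n) m)
      ≡⟨ ℤ-×≡* (suc n !) (partialProduct (suc n) m) ⟩
    + (suc n !) ℤ.* partialProduct (suc n) m ∎
    where hookSum = CycleSums.hookSum ℤ⟦x⟧

-- The infinite product and the comparison over ℚ.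

*-/-cancel : ∀ d .{{_ : ℕ.NonZero d}} i → (+ d ℤ.* i) ℚ./ d ≡ i ℚ./ 1
*-/-cancel d@(suc _) i = ℚ.fromℚᵘ-cong {ℚᵘ.mkℚᵘ (+ d ℤ.* i) (ℕ.pred d)} {ℚᵘ.mkℚᵘ i 0}
  (ℚᵘ.*≡* (≡.trans (ℤ.*-identityʳ _) (ℤ.*-comm (+ d) i)))

open import Data.Product.Base using (_×_)

theorem1p1 : (r : ℤ) →
    ∃[ P ] (IsInfiniteProduct (factor r) P × permutationSeries r ℚ⟦x,y⟧.≈ ℤ⇒ℚ P)
theorem1p1 r = P , isInfiniteProduct , coefficient
  where
  open Product r

  P : ℤ⟦x,y⟧.Carrier
  -- `suc m` is the least `N` for which degree `m` lies within the precision x^N.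
  P n m = partialProduct (suc m) n m

  stable : ∀ n m N → m ℕ.< N → partialProduct N n m ≡ P n m
  -- The identity with the permutation sum starts at n = 1; in degree 0 of y every partial product
  -- is 1.
  stable zero    m N m<N = ≡.trans (partialProduct-constantTerm N m) (≡.sym (partialProduct-constantTerm (suc m) m))
  stable (suc n) m N m<N = ℤ.*-cancelˡ-≡ (+ (suc n !)) _ _ {{ℕ._!≢0 (suc n)}}
    (≡.trans (≡.sym (permutationPowerSum N n m<N)) (permutationPowerSum (suc m) n ℕ.≤-refl))

  isInfiniteProduct : IsInfiniteProduct (factor r) P
  isInfiniteProduct n m = suc m , stable n m

  coefficient : permutationSeries r ℚ⟦x,y⟧.≈ ℤ⇒ℚ P
  coefficient zero    zero    = ≡.cong (ℚ._/ 1) (≡.sym (partialProduct-constantTerm 1 0))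
  coefficient zero    (suc m) = ≡.cong (ℚ._/ 1) (≡.sym (partialProduct-constantTerm (suc (suc m)) (suc m)))
  coefficient (suc n) m       = ≡.trans
    (≡.cong (λ i → (i ℚ./ (suc n !)) {{ℕ._!≢0 (suc n)}}) (permutationPowerSum (suc m) n ℕ.≤-refl))
    (*-/-cancel (suc n !) {{ℕ._!≢0 (suc n)}} (P (suc n) m))
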